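{- Let $G$ be a distance-regular graph of valency $k$ and diameter $d$, let $D=d+1$, let $\tilde{Q}=\frac1k Q$ where $Q$ is its quotient matrix, and write $\varphi(x)=\det(xI_D-\tilde{Q})=\sum_{i=0}^{D}\rho_i x^i$. If $G$ is periodic, then $2^j\rho_{D-j}\in\mathbb{Z}$ for every $j\in\{1,\dots,D-1\}$.
   Context: A finite connected $k$-regular graph $G$ of diameter $d$ is distance-regular if there are numbers $c_j,a_j,b_j$ ($0\le j\le d$) such that for all vertices $x$ and all $y$ at distance $j$ from $x$, $y$ has exactly $c_j$ neighbours at distance $j-1$, $a_j$ at distance $j$, and $b_j$ at distance $j+1$ from $x$ (with $c_0=b_d=0$). Its quotient matrix $Q$ is the $(d+1)\times(d+1)$ tridiagonal matrix with rows/columns indexed $0,\dots,d$, diagonal entries $Q_{j,j}=a_j$, superdiagonal entries $Q_{j,j+1}=b_j$ and subdiagonal entries $Q_{j+1,j}=c_{j+1}$. For a finite simple graph $G=(V,E)$, let $\mathcal{A}(G)=\{(u,v),(v,u) : uv\in E\}$; for an arc $e=(u,v)$ write $o(e)=u$, $t(e)=v$, $e^{ -1}=(v,u)$. The Grover transfer matrix $U$ is indexed by $\mathcal{A}(G)$ with $U_{e,f}=2/\deg(t(f))$ if $t(f)=o(e)$ and $e\neq f^{ -1}$; $U_{e,f}=2/\deg(t(f))-1$ if $e=f^{ -1}$; $U_{e,f}=0$ otherwise. $G$ is periodic if $U^m=I$ for some positive integer $m$. -}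

module Defs where

open import Data.Bool using (Bool; true; false; _∧_; _∨_; not; if_then_else_)
open import Data.Nat as ℕ using (ℕ; zero; suc; _≡ᵇ_; _≤_; _<_; _∸_)
open import Data.Fin using (Fin; toℕ; punchIn) renaming (zero to fzero; suc to fsuc)
open import Data.List using (List; []; _∷_; foldr; map; allFin; concatMap)
open import Data.Integer using (ℤ; +_)
open import Data.Rational using (ℚ; 0ℚ; 1ℚ; _+_; _*_; -_; _/_)
open import Data.Product using (Σ; _×_; _,_; ∃)
open import Relation.Binary.PropositionalEquality using (_≡_)

Graph : ℕ → Set
Graph n = Fin n → Fin n → Bool

_=ᶠ_ : ∀ {n} → Fin n → Fin n → Bool
i =ᶠ j = toℕ i ≡ᵇ toℕ j

IsSimpleGraph : ∀ {n} → Graph n → Set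
IsSimpleGraph {n} adj =
  (∀ u v → adj u v ≡ adj v u) × (∀ u → adj u u ≡ false)

count : ∀ {n} → (Fin n → Bool) → ℕ
count {n} p = foldr (λ i acc → if p i then suc acc else acc) 0 (allFin n)

anyFin : ∀ {n} → (Fin n → Bool) → Bool
anyFin {n} p = foldr (λ i acc → p i ∨ acc) false (allFin n)

deg : ∀ {n} → Graph n → Fin n → ℕ
deg adj v = count (λ w → adj v w)

ball : ∀ {n} → Graph n → ℕ → Fin n → Fin n → Bool
ball adj zero x y = x =ᶠ y
ball adj (suc j) x y = ball adj j x y ∨ anyFin (λ z → ball adj j x z ∧ adj z y)

atDist : ∀ {n} → Graph n → ℕ → Fin n → Fin n → Bool
atDist adj zero x y = ball adj zero x y
atDist adj (suc j) x y = ball adj (suc j) x y ∧ not (ball adj j x y)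

Connected : ∀ {n} → Graph n → Set
Connected adj = ∀ x y → ∃ λ j → ball adj j x y ≡ true

HasDiameter : ∀ {n} → Graph n → ℕ → Set
HasDiameter adj d =
  (∀ x y → ball adj d x y ≡ true) × (∃ λ x → ∃ λ y → atDist adj d x y ≡ true)

IsDistanceRegular : ∀ {n} → Graph n → (k d : ℕ) → (c a b : ℕ → ℕ) → Set
IsDistanceRegular adj k d c a b =
  IsSimpleGraph adj × Connected adj × (∀ v → deg adj v ≡ k) × HasDiameter adj d
  × c 0 ≡ 0 × b d ≡ 0
  × (∀ j → j ≤ d → ∀ x y → atDist adj j x y ≡ true →
        count (λ z → adj y z ∧ atDist adj j x z) ≡ a j
      × count (λ z → adj y z ∧ atDist adj (suc j) x z) ≡ b j)
  × (∀ j → suc j ≤ d → ∀ x y → atDist adj (suc j) x y ≡ true →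
        count (λ z → adj y z ∧ atDist adj j x z) ≡ c (suc j))

-- m / k in ℚ (for k = 0 we return 0; only used when k ≥ 1 matters)
divℕ : ℕ → ℕ → ℚ
divℕ m zero = 0ℚ
divℕ m (suc k) = (+ m) / suc k

quotientMatrix : (d : ℕ) → (c a b : ℕ → ℕ) → Fin (suc d) → Fin (suc d) → ℕ
quotientMatrix d c a b i j =
  if toℕ i ≡ᵇ toℕ j then a (toℕ i)
  else if toℕ j ≡ᵇ suc (toℕ i) then b (toℕ i)
  else if toℕ i ≡ᵇ suc (toℕ j) then c (toℕ i)
  else 0

normQuotientMatrix : (k d : ℕ) → (c a b : ℕ → ℕ) → Fin (suc d) → Fin (suc d) → ℚ
normQuotientMatrix k d c a b i j = divℕ (quotientMatrix d c a b i j) k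

-- Polynomials over ℚ as coefficient lists (constant term first)

Poly : Set
Poly = List ℚ

addP : Poly → Poly → Poly
addP [] q = q
addP (x ∷ p) [] = x ∷ p
addP (x ∷ p) (y ∷ q) = (x + y) ∷ addP p q

scaleP : ℚ → Poly → Poly
scaleP r = map (r *_)

mulP : Poly → Poly → Poly
mulP [] q = []
mulP (x ∷ p) q = addP (scaleP x q) (0ℚ ∷ mulP p q)

negP : Poly → Poly
negP = map -_

constP : ℚ → Poly
constP r = r ∷ []

coeff : Poly → ℕ → ℚ
coeff [] i = 0ℚ
coeff (x ∷ p) zero = x
coeff (x ∷ p) (suc i) = coeff p i

detP : (m : ℕ) → (Fin m → Fin m → Poly) → Poly
detP zero M = constP 1ℚ
detP (suc m) M =
  foldr addP []
    (map (λ j → sgn (toℕ j) (mulP (M fzero j) (detP m (λ i l → M (fsuc i) (punchIn j l)))))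
         (allFin (suc m)))
  where
  sgn : ℕ → Poly → Poly
  sgn zero p = p
  sgn (suc zero) p = negP p
  sgn (suc (suc t)) p = sgn t p

charPoly : (m : ℕ) → (Fin m → Fin m → ℚ) → Poly
charPoly m A = detP m (λ i j → if i =ᶠ j then (- A i j) ∷ 1ℚ ∷ [] else constP (- A i j))

Arc : ℕ → Set
Arc n = Fin n × Fin n

sumArcs : ∀ {n} → Graph n → (Arc n → ℚ) → ℚ
sumArcs {n} adj f =
  foldr _+_ 0ℚ
    (concatMap (λ u → map (λ v → if adj u v then f (u , v) else 0ℚ) (allFin n)) (allFin n))

-- U_{e,f} with e = (u , v), f = (w , x): o(e)=u, t(e)=v, t(f)=x, e = f⁻¹ iff u = x ∧ v = w
grover : ∀ {n} → Graph n → Arc n → Arc n → ℚ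
grover adj (u , v) (w , x) =
  if x =ᶠ u then
    (if v =ᶠ w then divℕ 2 (deg adj x) - 1ℚ else divℕ 2 (deg adj x))
  else 0ℚ
  where
  open import Data.Rational using (_-_)

idArc : ∀ {n} → Arc n → Arc n → ℚ
idArc (u , v) (w , x) = if (u =ᶠ w) ∧ (v =ᶠ x) then 1ℚ else 0ℚ

mulArc : ∀ {n} → Graph n → (Arc n → Arc n → ℚ) → (Arc n → Arc n → ℚ) → Arc n → Arc n → ℚ
mulArc adj A B e f = sumArcs adj (λ g → A e g * B g f)

powArc : ∀ {n} → Graph n → (Arc n → Arc n → ℚ) → ℕ → Arc n → Arc n → ℚ
powArc adj A zero = idArc
powArc adj A (suc m) = mulArc adj A (powArc adj A m)

IsArc : ∀ {n} → Graph n → Arc n → Set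
IsArc adj (u , v) = adj u v ≡ true

Periodic : ∀ {n} → Graph n → Set
Periodic adj = ∃ λ m → 1 ≤ m × (∀ e f → IsArc adj e → IsArc adj f →
  powArc adj (grover adj) m e f ≡ idArc e f)

-- On the arc space let T sum the incoming and T′ the outgoing values at a vertex.
-- Then T′U = T and TU = XT − T′ with X = 2A/k, so X(TUʲ⁺¹) = TUʲ⁺² + TUʲ.  Let ψ be the
-- indicator of an arc ending at x, so that Tψ = δₓ.  If Uᵐ = I, there are only m different
-- functions TUʲψ, hence the numbers (Xⁿδₓ)(y), n ∈ ℕ, have a common denominator.
-- When x and y are at distance d, (Xⁿδₓ)(y) = (Bⁿ)_{d,0} for B = 2Q/k, and since B is
-- tridiagonal Σₙ (Bⁿ)_{d,0} tⁿ = Γ tᵈ / det(I − tB) with Γ = B₁₀ B₂₁ ⋯ B_{d,d−1} ≠ 0.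
-- So Γ / det(I − tB) has bounded denominators, and Gauss's lemma makes the polynomial
-- det(I − tB), whose coefficients are the numbers 2ʲρ_{D−j}, integral.
module Submission where

open import Defs
open import Algebra.Bundles using (CommutativeRing)
open import Data.Bool using (Bool; true; false; _∧_; _∨_; not; if_then_else_)
open import Data.Bool.Properties using (∨-zeroʳ; ∧-zeroʳ)
open import Data.Fin using (Fin; toℕ; punchIn) renaming (zero to fzero; suc to fsuc)
open import Data.Integer using (ℤ)
import Data.Integer as ℤ
import Data.Integer.Properties as ℤ
open import Data.Integer.Divisibility.Signed using (_∣_; divides; _∣?_; ∣ᵤ⇒∣; ∣⇒∣ᵤ; ∣m⇒∣m*n; ∣n⇒∣m*n; ∣m∣n⇒∣m+n; ∣m+n∣m⇒∣n; ∣m+n∣n⇒∣m)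
open import Data.Integer.Solver using () renaming (module +-*-Solver to ℤ-Solver)
open import Data.List using (List; []; _∷_; foldr; map; allFin; tabulate; concatMap)
open import Data.List.Properties using (foldr-++)
open import Data.List.Relation.Unary.All using (All; []; _∷_)
open import Data.Nat using (ℕ; zero; suc; _≡ᵇ_; _≤_; _<_; _∸_; _^_; z≤n; s≤s)
import Data.Nat as ℕ
import Data.Nat.Properties as ℕ
import Data.Nat.Divisibility as ℕ
import Data.Nat.DivMod as ℕ
open import Data.Nat.ListAction using (product)
open import Data.Nat.Primality using (Prime; euclidsLemma; prime⇒nonZero)
open import Data.Nat.Primality.Factorisation using (PrimeFactorisation; factorise)
open import Data.Product using (∃; _,_; _×_; proj₁; proj₂)
open import Data.Rational using (ℚ; 0ℚ; 1ℚ; _+_; _*_; -_; _-_; _/_; 1/_; toℚᵘ; ↥_; ↧ₙ_; ≢-nonZero; NonZero)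
open import Data.Rational.Properties hiding (_≟_)
open import Data.Rational.Solver using (module +-*-Solver)
open import Data.Rational.Unnormalised using (mkℚᵘ; *≡*)
import Data.Rational.Unnormalised as ℚᵘ
import Data.Rational.Unnormalised.Properties as ℚᵘ
open import Data.Sum using (_⊎_; inj₁; inj₂)
open import Relation.Binary.PropositionalEquality
open import Relation.Nullary using (yes; no; contradiction)
open import Algebra.Properties.Semiring.Sum (CommutativeRing.semiring +-*-commutativeRing) using (sum; sum-cong-≗; ∑-distrib-+)
open +-*-Solver using (solve; _:=_; _:+_; _:*_; :-_; _:-_; con)

-- Laplace expansion of a tridiagonal determinant

-- No eigenvalue appears: instead of showing that twice each eigenvalue of A/k is an algebraic
-- integer, the proof stays over ℚ and works with bounded denominators of a power series. They are
-- bounded because the recurrence expands Xⁿ(TUʲψ) into a sum of functions TUⁱψ with natural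
-- coefficients, and i may be read modulo m. The entry (d,0) is chosen because its numerator in the
-- resolvent is a monomial: once tᵈ is stripped, determinant times series is the constant Γ, so no
-- common factor can hide a denominator of the determinant. Scaling both to integer coefficients
-- gives a product that is a nonzero integer. Its primes are removed one at a time, each from one of
-- the two factors, until the constant term of the polynomial is a unit; hence that term divides all
-- coefficients. As the determinant has constant term 1, this is integrality.

cofactor : (m : ℕ) → (Fin (suc m) → Fin (suc m) → Poly) → Fin (suc m) → Poly
cofactor m M j = mulP (M fzero j) (detP m (λ i l → M (fsuc i) (punchIn j l)))

-- The sign function of the Laplace expansion is local to detP, so it cannot be
-- named; it is recovered as the solution of the unification problems below.
term : (m : ℕ) → (Fin (suc m) → Fin (suc m) → Poly) → Fin (suc m) → Poly
detP-suc : ∀ m M → detP (suc m) M ≡ foldr addP [] (map (term m M) (allFin (suc m)))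
term = _
detP-suc m M = refl

sgn : (m : ℕ) → (Fin (suc m) → Fin (suc m) → Poly) → ℕ → Poly → Poly
term≡sgn : ∀ m M j → term m M j ≡ sgn m M (toℕ j) (cofactor m M j)
sgn = _
-- Abstracting both arguments leaves the unknown applied to distinct variables, and such an unknown
-- is determined by unification.
term≡sgn m M j with toℕ j | cofactor m M j
... | t | p = refl

Seq : Set
Seq = ℕ → ℚ

δ₀ : Seq
δ₀ zero = 1ℚ
δ₀ (suc n) = 0ℚ

shift : ℕ → Seq → Seq
shift zero f n = f n
shift (suc i) f zero = 0ℚ
shift (suc i) f (suc n) = shift i f n

Zero : Poly → Set
Zero p = ∀ n → coeff p n ≡ 0ℚ

coeff-addP : ∀ p q n → coeff (addP p q) n ≡ coeff p n + coeff q n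
coeff-addP [] q n = sym (+-identityˡ _)
coeff-addP (x ∷ p) [] n = sym (+-identityʳ _)
coeff-addP (x ∷ p) (y ∷ q) zero = refl
coeff-addP (x ∷ p) (y ∷ q) (suc n) = coeff-addP p q n

coeff-scaleP : ∀ r p n → coeff (scaleP r p) n ≡ r * coeff p n
coeff-scaleP r [] n = sym (*-zeroʳ r)
coeff-scaleP r (x ∷ p) zero = refl
coeff-scaleP r (x ∷ p) (suc n) = coeff-scaleP r p n

coeff-negP : ∀ p n → coeff (negP p) n ≡ - coeff p n
coeff-negP [] n = refl
coeff-negP (x ∷ p) zero = refl
coeff-negP (x ∷ p) (suc n) = coeff-negP p n

coeff-0∷ : ∀ p n → coeff (0ℚ ∷ p) n ≡ shift 1 (coeff p) n
coeff-0∷ p zero = refl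
coeff-0∷ p (suc n) = refl

coeff-mulP-∷ : ∀ x p q n → coeff (mulP (x ∷ p) q) n ≡ x * coeff q n + shift 1 (coeff (mulP p q)) n
coeff-mulP-∷ x p q n = trans (coeff-addP (scaleP x q) _ n) (cong₂ _+_ (coeff-scaleP x q n) (coeff-0∷ (mulP p q) n))

shift-zero : ∀ {f} → (∀ n → f n ≡ 0ℚ) → ∀ i n → shift i f n ≡ 0ℚ
shift-zero f≡0 zero n = f≡0 n
shift-zero f≡0 (suc i) zero = refl
shift-zero f≡0 (suc i) (suc n) = shift-zero f≡0 i n

shift-cong : ∀ {f g} → (∀ n → f n ≡ g n) → ∀ i n → shift i f n ≡ shift i g n
shift-cong f≡g zero n = f≡g n
shift-cong f≡g (suc i) zero = refl
shift-cong f≡g (suc i) (suc n) = shift-cong f≡g i n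

mulP-zeroˡ : ∀ p q → Zero p → Zero (mulP p q)
mulP-zeroˡ [] q z n = refl
mulP-zeroˡ (x ∷ p) q z n = begin
  coeff (mulP (x ∷ p) q) n                         ≡⟨ coeff-mulP-∷ x p q n ⟩
  x * coeff q n + shift 1 (coeff (mulP p q)) n     ≡⟨ cong₂ _+_ (cong (_* coeff q n) (z 0)) (shift-zero (mulP-zeroˡ p q (λ i → z (suc i))) 1 n) ⟩
  0ℚ * coeff q n + 0ℚ                              ≡⟨ cong (_+ 0ℚ) (*-zeroˡ (coeff q n)) ⟩
  0ℚ                                               ∎
  where open ≡-Reasoning

mulP-zeroʳ : ∀ p q → Zero q → Zero (mulP p q)
mulP-zeroʳ [] q z n = refl
mulP-zeroʳ (x ∷ p) q z n = begin
  coeff (mulP (x ∷ p) q) n                         ≡⟨ coeff-mulP-∷ x p q n ⟩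
  x * coeff q n + shift 1 (coeff (mulP p q)) n     ≡⟨ cong₂ _+_ (cong (x *_) (z n)) (shift-zero (mulP-zeroʳ p q z) 1 n) ⟩
  x * 0ℚ + 0ℚ                                      ≡⟨ cong (_+ 0ℚ) (*-zeroʳ x) ⟩
  0ℚ                                               ∎
  where open ≡-Reasoning

coeff-mulP-constP : ∀ x q n → coeff (mulP (constP x) q) n ≡ x * coeff q n
coeff-mulP-constP x q n = trans (coeff-mulP-∷ x [] q n)
  (trans (cong (x * coeff q n +_) (shift-zero (λ _ → refl) 1 n)) (+-identityʳ _))

coeff-mulP-linear : ∀ x q n → coeff (mulP (x ∷ 1ℚ ∷ []) q) n ≡ x * coeff q n + shift 1 (coeff q) n
coeff-mulP-linear x q n = trans (coeff-mulP-∷ x (constP 1ℚ) q n)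
  (cong (x * coeff q n +_) (shift-cong (λ i → trans (coeff-mulP-constP 1ℚ q i) (*-identityˡ _)) 1 n))

sgn-zero : ∀ m M t p → Zero p → Zero (sgn m M t p)
sgn-zero m M zero p z = z
sgn-zero m M (suc zero) p z n = trans (coeff-negP p n) (cong -_ (z n))
sgn-zero m M (suc (suc t)) p z = sgn-zero m M t p z

term-zero : ∀ m M j → Zero (cofactor m M j) → Zero (term m M j)
term-zero m M j z = subst Zero (sym (term≡sgn m M j)) (sgn-zero m M (toℕ j) _ z)

sumP-zero : ∀ {A : Set} {m} (F : A → Poly) (g : Fin m → A) → (∀ j → Zero (F (g j))) →
           Zero (foldr addP [] (map F (tabulate g)))
sumP-zero {m = zero} F g z n = refl
sumP-zero {m = suc m} F g z n = trans (coeff-addP (F (g fzero)) _ n)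
  (cong₂ _+_ (z fzero n) (sumP-zero F (λ j → g (fsuc j)) (λ j → z (fsuc j)) n))

detP-one-term : ∀ m M → (∀ j → Zero (cofactor m M (fsuc j))) →
                ∀ n → coeff (detP (suc m) M) n ≡ coeff (cofactor m M fzero) n
detP-one-term m M z n = trans (coeff-addP (cofactor m M fzero) _ n)
  (trans (cong (coeff (cofactor m M fzero) n +_) (sumP-zero (term m M) fsuc (λ j → term-zero m M (fsuc j) (z j)) n))
         (+-identityʳ _))

detP-two-terms : ∀ m M → (∀ j → Zero (cofactor (suc m) M (fsuc (fsuc j)))) →
                 ∀ n → coeff (detP (suc (suc m)) M) n
                     ≡ coeff (cofactor (suc m) M fzero) n - coeff (cofactor (suc m) M (fsuc fzero)) n
detP-two-terms m M z n = begin
  coeff (detP (suc (suc m)) M) n                ≡⟨ coeff-addP C₀ (addP (negP C₁) R) n ⟩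
  coeff C₀ n + coeff (addP (negP C₁) R) n       ≡⟨ cong (coeff C₀ n +_) (coeff-addP (negP C₁) R n) ⟩
  coeff C₀ n + (coeff (negP C₁) n + coeff R n)  ≡⟨ cong (coeff C₀ n +_) (cong₂ _+_ (coeff-negP C₁ n) R≈0) ⟩
  coeff C₀ n + (- coeff C₁ n + 0ℚ)              ≡⟨ cong (coeff C₀ n +_) (+-identityʳ _) ⟩
  coeff C₀ n - coeff C₁ n                       ∎
  where
  open ≡-Reasoning
  C₀ C₁ R : Poly
  C₀ = cofactor (suc m) M fzero
  C₁ = cofactor (suc m) M (fsuc fzero)
  R = foldr addP [] (map (term (suc m) M) (tabulate (λ j → fsuc (fsuc j))))
  R≈0 : coeff R n ≡ 0ℚ
  R≈0 = sumP-zero (term (suc m) M) (λ j → fsuc (fsuc j)) (λ j → term-zero (suc m) M (fsuc (fsuc j)) (z j)) n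

-- In the expansion along the first row, the zero column contributes a zero entry, and every other
-- minor keeps that column in first place because `punchIn (fsuc j)` fixes `fzero`.
detP-zero-column : ∀ m M → (∀ i → Zero (M i fzero)) → Zero (detP (suc m) M)
detP-zero-column m M z n = trans (detP-one-term m M (rest m M z) n) (mulP-zeroˡ (M fzero fzero) _ (z fzero) n)
  where
  rest : ∀ m M → (∀ i → Zero (M i fzero)) → ∀ j → Zero (cofactor m M (fsuc j))
  rest (suc m) M z j = mulP-zeroʳ (M fzero (fsuc j)) _
    (detP-zero-column m (λ i l → M (fsuc i) (punchIn (fsuc j) l)) (λ i → z (fsuc i)))

-- Entries are indexed by pairs of naturals so that deleting the first row and column is the index
-- shift `_↘`. The characteristic polynomial of the quotient matrix is such a corner by computation
-- alone.
corner : (ℕ → ℕ → Poly) → ℕ → Poly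
corner X e = detP e (λ i j → X (toℕ i) (toℕ j))

_↘ : (ℕ → ℕ → Poly) → ℕ → ℕ → Poly
(X ↘) i j = X (suc i) (suc j)

module _ (X : ℕ → ℕ → Poly) (x : ℚ) (X₀₀ : X 0 0 ≡ x ∷ 1ℚ ∷ []) where

  corner-1 : ∀ n → coeff (corner X 1) n ≡ x * δ₀ n + shift 1 δ₀ n
  corner-1 n = begin
    coeff (corner X 1) n                                  ≡⟨ detP-one-term 0 (λ i j → X (toℕ i) (toℕ j)) (λ ()) n ⟩
    coeff (mulP (X 0 0) (constP 1ℚ)) n                    ≡⟨ cong (λ e → coeff (mulP e (constP 1ℚ)) n) X₀₀ ⟩
    coeff (mulP (x ∷ 1ℚ ∷ []) (constP 1ℚ)) n              ≡⟨ coeff-mulP-linear x (constP 1ℚ) n ⟩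
    x * coeff (constP 1ℚ) n + shift 1 (coeff (constP 1ℚ)) n  ≡⟨ cong₂ _+_ (cong (x *_) (one n)) (shift-cong one 1 n) ⟩
    x * δ₀ n + shift 1 δ₀ n                               ∎
    where
    open ≡-Reasoning
    one : ∀ n → coeff (constP 1ℚ) n ≡ δ₀ n
    one zero = refl
    one (suc n) = refl

  module _ (y z : ℚ) (X₀₁ : X 0 1 ≡ constP y) (X₁₀ : X 1 0 ≡ constP z)
           (row : ∀ j → Zero (X 0 (suc (suc j)))) (column : ∀ i → Zero (X (suc (suc i)) 0)) where

    -- Only the entries (0,0) and (0,1) of the first row can contribute, and the minor of (0,1)
    -- again has at most one nonzero entry, `X 1 0`, in its first column.
    corner-suc² : ∀ e n → coeff (corner X (suc (suc e))) n ≡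
      (x * coeff (corner (X ↘) (suc e)) n + shift 1 (coeff (corner (X ↘) (suc e))) n)
      - y * (z * coeff (corner (X ↘ ↘) e) n)
    corner-suc² e n = trans
      (detP-two-terms e M (λ j → mulP-zeroˡ (M fzero (fsuc (fsuc j))) _ (row (toℕ j))) n)
      (cong₂ _-_
        (trans (cong (λ f → coeff (mulP f (corner (X ↘) (suc e))) n) X₀₀) (coeff-mulP-linear x (corner (X ↘) (suc e)) n))
        (trans (cong (λ f → coeff (mulP f (detP (suc e) N)) n) X₀₁)
        (trans (coeff-mulP-constP y (detP (suc e) N) n)
        (cong (y *_)
        (trans (detP-one-term e N (rest e) n)
        (trans (cong (λ f → coeff (mulP f (corner (X ↘ ↘) e)) n) X₁₀)
        (coeff-mulP-constP z (corner (X ↘ ↘) e) n)))))))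
      where
      M : ∀ {e} → Fin (suc (suc e)) → Fin (suc (suc e)) → Poly
      M i j = X (toℕ i) (toℕ j)
      N : ∀ {e} → Fin (suc e) → Fin (suc e) → Poly
      N i l = M (fsuc i) (punchIn (fsuc fzero) l)
      rest : ∀ e j → Zero (cofactor e N (fsuc j))
      rest (suc e) j = mulP-zeroʳ (N fzero (fsuc j)) _
        (detP-zero-column e (λ i l → N (fsuc i) (punchIn (fsuc j) l)) (λ i → column (toℕ i)))

-- The characteristic polynomial as a continuant

2ℚ : ℚ
2ℚ = 1ℚ + 1ℚ

2^_ : ℕ → ℚ
2^ zero = 1ℚ
2^ suc j = 2ℚ * 2^ j

-- f and g are the coefficient sequences of P(x) and xᵉ P(2/x), with deg P ≤ e.
record Reciprocal (e : ℕ) (f g : Seq) : Set where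
  field
    reverse : ∀ j n → j ℕ.+ n ≡ e → 2^ j * f n ≡ g j
    degˡ    : ∀ n → e < n → f n ≡ 0ℚ
    degʳ    : ∀ j → e < j → g j ≡ 0ℚ

open Reciprocal

reciprocal-cong : ∀ {e f f′ g g′} → (∀ n → f′ n ≡ f n) → (∀ n → g′ n ≡ g n) →
                  Reciprocal e f g → Reciprocal e f′ g′
reciprocal-cong p q r .reverse j n eq = trans (cong (2^ j *_) (p n)) (trans (reverse r j n eq) (sym (q j)))
reciprocal-cong p q r .degˡ n lt = trans (p n) (degˡ r n lt)
reciprocal-cong p q r .degʳ j lt = trans (q j) (degʳ r j lt)

reciprocal-δ₀ : Reciprocal 0 δ₀ δ₀
reciprocal-δ₀ .reverse zero zero refl = refl
reciprocal-δ₀ .degˡ (suc n) lt = refl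
reciprocal-δ₀ .degʳ (suc n) lt = refl

-- `g` lists the coefficients of (2t)ᵉ P(1/(2t)). Multiplying P by its variable while `e` grows by
-- one therefore leaves `g` alone; letting only `e` grow multiplies by 2t, which is
-- `reciprocal-shiftʳ`.
reciprocal-shiftˡ : ∀ {e f g} → Reciprocal e f g → Reciprocal (suc e) (shift 1 f) g
reciprocal-shiftˡ r .reverse j zero eq =
  trans (*-zeroʳ (2^ j)) (sym (degʳ r j (ℕ.≤-reflexive (trans (sym eq) (ℕ.+-identityʳ j)))))
reciprocal-shiftˡ r .reverse j (suc n) eq = reverse r j n (ℕ.suc-injective (trans (sym (ℕ.+-suc j n)) eq))
reciprocal-shiftˡ r .degˡ (suc n) (s≤s lt) = degˡ r n lt
reciprocal-shiftˡ r .degʳ j lt = degʳ r j (ℕ.<-trans (ℕ.n<1+n _) lt)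

reciprocal-shiftʳ : ∀ {e f g} → Reciprocal e f g → Reciprocal (suc e) f (λ j → 2ℚ * shift 1 g j)
reciprocal-shiftʳ r .reverse zero n eq = trans (*-identityˡ _) (degˡ r n (ℕ.≤-reflexive (sym eq)))
reciprocal-shiftʳ r .reverse (suc j) n eq =
  trans (*-assoc 2ℚ (2^ j) _) (cong (2ℚ *_) (reverse r j n (ℕ.suc-injective eq)))
reciprocal-shiftʳ r .degˡ n lt = degˡ r n (ℕ.<-trans (ℕ.n<1+n _) lt)
reciprocal-shiftʳ r .degʳ (suc j) (s≤s lt) = trans (cong (2ℚ *_) (degʳ r j lt)) (*-zeroʳ 2ℚ)

reciprocal-+ : ∀ {e f f′ g g′} → Reciprocal e f g → Reciprocal e f′ g′ →
               Reciprocal e (λ n → f n + f′ n) (λ n → g n + g′ n)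
reciprocal-+ r s .reverse j n eq = trans (*-distribˡ-+ (2^ j) _ _) (cong₂ _+_ (reverse r j n eq) (reverse s j n eq))
reciprocal-+ r s .degˡ n lt = cong₂ _+_ (degˡ r n lt) (degˡ s n lt)
reciprocal-+ r s .degʳ n lt = cong₂ _+_ (degʳ r n lt) (degʳ s n lt)

reciprocal-* : ∀ {e f g} x → Reciprocal e f g → Reciprocal e (λ n → x * f n) (λ n → x * g n)
reciprocal-* {f = f} x r .reverse j n eq =
  trans (solve 3 (λ x p f → p :* (x :* f) := x :* (p :* f)) refl x (2^ j) (f n)) (cong (x *_) (reverse r j n eq))
reciprocal-* x r .degˡ n lt = trans (cong (x *_) (degˡ r n lt)) (*-zeroʳ x)
reciprocal-* x r .degʳ n lt = trans (cong (x *_) (degʳ r n lt)) (*-zeroʳ x)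

-- The coefficient sequence of det (I - t B), where B is the e × e tridiagonal
-- matrix with diagonal entries α i and κ i = B i (i+1) · B (i+1) i.
continuant : ℕ → Seq → Seq → Seq
continuant zero          α κ n = δ₀ n
continuant (suc zero)    α κ n = δ₀ n - α 0 * shift 1 δ₀ n
continuant (suc (suc e)) α κ n =
  continuant (suc e) (λ i → α (suc i)) (λ i → κ (suc i)) n
  - α 0 * shift 1 (continuant (suc e) (λ i → α (suc i)) (λ i → κ (suc i))) n
  - κ 0 * shift 2 (continuant e (λ i → α (suc (suc i))) (λ i → κ (suc (suc i)))) n

shift-* : ∀ x f i n → shift i (λ j → x * f j) n ≡ x * shift i f n
shift-* x f zero n = refl
shift-* x f (suc i) zero = sym (*-zeroʳ x)
shift-* x f (suc i) (suc n) = shift-* x f i n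

shift-1-1 : ∀ f n → shift 1 (shift 1 f) n ≡ shift 2 f n
shift-1-1 f zero = refl
shift-1-1 f (suc zero) = refl
shift-1-1 f (suc (suc n)) = refl

divℕ-zeroˡ : ∀ k → - divℕ 0 k ≡ 0ℚ
divℕ-zeroˡ zero = refl
divℕ-zeroˡ (suc k) = cong -_ (0/n≡0 (suc k))

module _ (k : ℕ) where

  charEntry : (c a b : ℕ → ℕ) → ℕ → ℕ → Poly
  charEntry c a b i j = if i ≡ᵇ j then (- entry) ∷ 1ℚ ∷ [] else constP (- entry)
    where
    entry : ℚ
    entry = divℕ (if i ≡ᵇ j then a i
                  else if j ≡ᵇ suc i then b i
                  else if i ≡ᵇ suc j then c i
                  else 0) k

  diag : (ℕ → ℕ) → Seq
  diag a i = 2ℚ * divℕ (a i) k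

  offdiag : (b c : ℕ → ℕ) → Seq
  offdiag b c i = (2ℚ * divℕ (b i) k) * (2ℚ * divℕ (c (suc i)) k)

  constP-zero : Zero (constP (- divℕ 0 k))
  constP-zero zero = divℕ-zeroˡ k
  constP-zero (suc n) = refl

  -- Reversal turns one three-term recurrence into the other: x - A becomes 1 - 2At, and the product
  -- BC, attached to a determinant two sizes smaller, collects (2t)².
  charPoly-reciprocal : ∀ e c a b →
    Reciprocal e (coeff (corner (charEntry c a b) e)) (continuant e (diag a) (offdiag b c))
  charPoly-reciprocal zero c a b = reciprocal-cong (λ { zero → refl ; (suc n) → refl }) (λ n → refl) reciprocal-δ₀
  charPoly-reciprocal (suc zero) c a b = reciprocal-cong
    (corner-1 (charEntry c a b) (- A) refl)
    (λ n → solve 4 (λ t u A s → u :- (t :* A) :* s := :- A :* (t :* s) :+ u) refl 2ℚ (δ₀ n) A (shift 1 δ₀ n))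
    (reciprocal-+ (reciprocal-* (- A) (reciprocal-shiftʳ reciprocal-δ₀)) (reciprocal-shiftˡ reciprocal-δ₀))
    where
    A : ℚ
    A = divℕ (a 0) k
  charPoly-reciprocal (suc (suc e)) c a b =
    let r₁ = charPoly-reciprocal (suc e) (λ i → c (suc i)) (λ i → a (suc i)) (λ i → b (suc i))
        r₂ = charPoly-reciprocal e (λ i → c (suc (suc i))) (λ i → a (suc (suc i))) (λ i → b (suc (suc i)))
    in reciprocal-cong
    (λ n → trans (corner-suc² X (- A) refl (- B) (- C) refl refl (λ j → constP-zero) (λ i → constP-zero) e n)
                 (solve 6 (λ A B C f s g → (:- A :* f :+ s) :- (:- B :* (:- C :* g)) := (:- A :* f :+ s) :+ :- (B :* C) :* g)
                          refl A B C (f₁ n) (shift 1 f₁ n) (f₂ n)))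
    (λ n → trans (solve 7 (λ t A B C g s h → g :- (t :* A) :* s :- ((t :* B) :* (t :* C)) :* h
                                          := (:- A :* (t :* s) :+ g) :+ :- (B :* C) :* (t :* (t :* h)))
                          refl 2ℚ A B C (g₁ n) (shift 1 g₁ n) (shift 2 g₂ n))
                 (cong (λ h → (- A * (2ℚ * shift 1 g₁ n) + g₁ n) + - (B * C) * (2ℚ * h))
                       (sym (trans (shift-* 2ℚ (shift 1 g₂) 1 n) (cong (2ℚ *_) (shift-1-1 g₂ n))))))
    (reciprocal-+
      (reciprocal-+ (reciprocal-* (- A) (reciprocal-shiftʳ r₁)) (reciprocal-shiftˡ r₁))
      (reciprocal-* (- (B * C)) (reciprocal-shiftʳ (reciprocal-shiftʳ r₂))))
    where
    A B C : ℚ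
    A = divℕ (a 0) k
    B = divℕ (b 0) k
    C = divℕ (c 1) k
    X : ℕ → ℕ → Poly
    X = charEntry c a b
    f₁ f₂ g₁ g₂ : Seq
    f₁ = coeff (corner (X ↘) (suc e))
    f₂ = coeff (corner (X ↘ ↘) e)
    g₁ = continuant (suc e) (λ i → diag a (suc i)) (λ i → offdiag b c (suc i))
    g₂ = continuant e (λ i → diag a (suc (suc i))) (λ i → offdiag b c (suc (suc i)))

-- The resolvent of a tridiagonal matrix

conv : Seq → Seq → Seq
conv f y zero = f 0 * y 0
conv f y (suc n) = f 0 * y (suc n) + conv (λ s → f (suc s)) y n

conv-cong : ∀ f {y z} → (∀ n → y n ≡ z n) → ∀ n → conv f y n ≡ conv f z n
conv-cong f y≡z zero = cong (f 0 *_) (y≡z 0)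
conv-cong f y≡z (suc n) = cong₂ _+_ (cong (f 0 *_) (y≡z (suc n))) (conv-cong _ y≡z n)

-- `conv` recurses on its left factor. Splitting off the first term of the right factor instead is
-- what exposes `column (suc m)` as `apply (column m)`.
conv-last : ∀ f y n → conv f y (suc n) ≡ f (suc n) * y 0 + conv f (λ m → y (suc m)) n
conv-last f y zero = +-comm (f 0 * y 1) (f 1 * y 0)
conv-last f y (suc n) = trans (cong (f 0 * y (suc (suc n)) +_) (conv-last (λ s → f (suc s)) y n))
  (solve 3 (λ a b c → a :+ (b :+ c) := b :+ (a :+ c)) refl (f 0 * y (suc (suc n))) (f (suc (suc n)) * y 0) (conv (λ s → f (suc s)) (λ m → y (suc m)) n))

conv-linear : ∀ f a u b v c w n → conv f (λ m → a * u m + b * v m + c * w m) n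
                                ≡ a * conv f u n + b * conv f v n + c * conv f w n
conv-linear f a u b v c w zero =
  solve 7 (λ f a u b v c w → f :* (a :* u :+ b :* v :+ c :* w) := a :* (f :* u) :+ b :* (f :* v) :+ c :* (f :* w))
        refl (f 0) a (u 0) b (v 0) c (w 0)
conv-linear f a u b v c w (suc n) =
  trans (cong (f 0 * (a * u (suc n) + b * v (suc n) + c * w (suc n)) +_) (conv-linear (λ s → f (suc s)) a u b v c w n))
  (solve 10 (λ f a u b v c w U V W → f :* (a :* u :+ b :* v :+ c :* w) :+ (a :* U :+ b :* V :+ c :* W)
                 := a :* (f :* u :+ U) :+ b :* (f :* v :+ V) :+ c :* (f :* w :+ W))
        refl (f 0) a (u (suc n)) b (v (suc n)) c (w (suc n))
        (conv (λ s → f (suc s)) u n) (conv (λ s → f (suc s)) v n) (conv (λ s → f (suc s)) w n))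

shift-recurrence : ∀ {f g h} α κ → (∀ n → g n ≡ f n - α * shift 1 f n - κ * shift 2 h n) →
  ∀ i n → shift i g n ≡ shift i f n - α * shift (suc i) f n - κ * shift (suc (suc i)) h n
shift-recurrence α κ eq zero n = eq n
shift-recurrence α κ eq (suc i) zero = solve 2 (λ α κ → con 0ℚ := con 0ℚ :- α :* con 0ℚ :- κ :* con 0ℚ) refl α κ
shift-recurrence {f} {g} {h} α κ eq (suc i) (suc n) = shift-recurrence {f} {g} {h} α κ eq i n

drop : ℕ → Seq → Seq
drop zero f = f
drop (suc i) f = drop i (λ s → f (suc s))

drop-suc : ∀ i f → drop (suc i) f ≡ (λ s → drop i f (suc s))
drop-suc zero f = refl
drop-suc (suc i) f = drop-suc i (λ s → f (suc s))

drop-head : ∀ i f → drop i f 0 ≡ f i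
drop-head zero f = refl
drop-head (suc i) f = drop-head i (λ s → f (suc s))

continuant-head : ∀ e α κ → continuant e α κ 0 ≡ 1ℚ
continuant-head zero α κ = refl
continuant-head (suc zero) α κ = solve 1 (λ α → con 1ℚ :- α :* con 0ℚ := con 1ℚ) refl (α 0)
continuant-head (suc (suc e)) α κ = trans
  (solve 3 (λ p α κ → p :- α :* con 0ℚ :- κ :* con 0ℚ := p) refl (continuant (suc e) (λ i → α (suc i)) (λ i → κ (suc i)) 0) (α 0) (κ 0))
  (continuant-head (suc e) _ _)

module Tridiagonal (d : ℕ) (α β γ : Seq) (β-last : β d ≡ 0ℚ) where

  -- A tridiagonal matrix acting on infinite sequences. Since `β d` vanishes, the entries 0 to d
  -- evolve by themselves; there this is the square matrix B of size d + 1, and `column n i` is the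
  -- entry (i,0) of Bⁿ.
  apply : Seq → Seq
  apply h i = α i * h i + β i * h (suc i) + γ i * shift 1 h i

  column : ℕ → Seq
  column zero = δ₀
  column (suc n) = apply (column n)

  κ : Seq
  κ i = β i * γ (suc i)

  -- This is det(I - tB) for the block of B with indices i to d; the empty block gives 1.
  trailing : ℕ → Seq
  trailing i = continuant (suc d ∸ i) (drop i α) (drop i κ)

  Γ : Seq
  Γ zero = 1ℚ
  Γ (suc i) = γ (suc i) * Γ i

  trailing-last : ∀ n → trailing (suc d) n ≡ δ₀ n
  trailing-last n = cong (λ e → continuant e (drop (suc d) α) (drop (suc d) κ) n) (ℕ.n∸n≡0 d)

  trailing-step : ∀ i → i ≤ d → ∀ n →
    trailing i n ≡ trailing (suc i) n - α i * shift 1 (trailing (suc i)) n - κ i * shift 2 (trailing (suc (suc i))) n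
  trailing-step i i≤d n with ℕ.m≤n⇒m<n∨m≡n i≤d
  ... | inj₁ i<d rewrite ℕ.+-∸-assoc 1 i≤d | sym (ℕ.suc-pred (d ∸ i) {{ℕ.>-nonZero (ℕ.m<n⇒0<n∸m i<d)}})
                       | ℕ.pred[m∸n]≡m∸[1+n] d i
                       | drop-suc (suc i) α | drop-suc (suc i) κ | drop-suc i α | drop-suc i κ
                       | drop-head i α | drop-head i κ = refl
  -- At i = d the block has size one and its continuant has no `κ` term; `β d` being zero allows one
  -- to be added.
  ... | inj₂ refl = begin
    continuant (suc d ∸ d) (drop d α) (drop d κ) n      ≡⟨ cong (λ e → continuant e (drop d α) (drop d κ) n) (ℕ.m+n∸n≡m 1 d) ⟩
    δ₀ n - drop d α 0 * shift 1 δ₀ n                    ≡⟨ cong (λ a → δ₀ n - a * shift 1 δ₀ n) (drop-head d α) ⟩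
    δ₀ n - α d * shift 1 δ₀ n                           ≡⟨ cong₂ (λ x y → x - α d * y) (trailing-last n) (shift-cong trailing-last 1 n) ⟨
    t n - α d * shift 1 t n                             ≡⟨ solve 3 (λ x g s → x := x :- con 0ℚ :* g :* s) refl _ (γ (suc d)) (shift 2 t′ n) ⟩
    t n - α d * shift 1 t n - 0ℚ * γ (suc d) * shift 2 t′ n  ≡⟨ cong (λ b → t n - α d * shift 1 t n - b * γ (suc d) * shift 2 t′ n) β-last ⟨
    t n - α d * shift 1 t n - κ d * shift 2 t′ n        ∎
    where
    open ≡-Reasoning
    t t′ : Seq
    t = trailing (suc d)
    t′ = trailing (suc (suc d))

  -- Cramer's rule for the first column of the inverse of I - tB. Adjugates are avoided: the series
  -- of the `column _ i` solve y = e₀ + tBy, so induction on the exponent, row by row, reduces the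
  -- claim to `trailing-step`.
  charPoly-conv-column : ∀ n i → i ≤ d → conv (trailing 0) (λ m → column m i) n ≡ Γ i * shift i (trailing (suc i)) n
  charPoly-conv-column zero zero _ = trans (cong (_* 1ℚ) (trailing-step 0 z≤n 0))
    (solve 3 (λ t α κ → (t :- α :* con 0ℚ :- κ :* con 0ℚ) :* con 1ℚ := con 1ℚ :* t) refl (trailing 1 0) (α 0) (κ 0))
  charPoly-conv-column zero (suc i) _ = solve 2 (λ t g → t :* con 0ℚ := g :* con 0ℚ) refl (trailing 0 0) (Γ (suc i))
  charPoly-conv-column (suc n) i i≤d = begin
    conv p₀ (λ m → column m i) (suc n)                  ≡⟨ conv-last p₀ (λ m → column m i) n ⟩
    p₀ (suc n) * δ₀ i + conv p₀ (λ m → apply (column m) i) n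
      ≡⟨ cong (p₀ (suc n) * δ₀ i +_) (conv-linear p₀ (α i) _ (β i) _ (γ i) _ n) ⟩
    p₀ (suc n) * δ₀ i + (α i * C i + β i * C (suc i) + γ i * conv p₀ (λ m → shift 1 (column m) i) n)
      ≡⟨ cong (p₀ (suc n) * δ₀ i +_) (cong₂ (λ x y → α i * x + y + γ i * conv p₀ (λ m → shift 1 (column m) i) n)
              (charPoly-conv-column n i i≤d) above) ⟩
    p₀ (suc n) * δ₀ i + (α i * (Γ i * P) + β i * (Γ (suc i) * Q) + γ i * conv p₀ (λ m → shift 1 (column m) i) n)
      ≡⟨ below i i≤d ⟩
    Γ i * shift i (trailing (suc i)) (suc n)            ∎
    where
    open ≡-Reasoning
    p₀ : Seq
    p₀ = trailing 0
    C : Seq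
    C i = conv p₀ (λ m → column m i) n
    P Q : ℚ
    P = shift i (trailing (suc i)) n
    Q = shift (suc i) (trailing (suc (suc i))) n
    -- For i = d this term refers to the index d + 1, outside the claim, but its weight `β d` is
    -- zero.
    above : β i * C (suc i) ≡ β i * (Γ (suc i) * Q)
    above with ℕ.m≤n⇒m<n∨m≡n i≤d
    ... | inj₁ i<d = cong (β i *_) (charPoly-conv-column n (suc i) i<d)
    ... | inj₂ refl = trans (cong (_* C (suc i)) β-last)
      (trans (solve 2 (λ x y → con 0ℚ :* x := con 0ℚ :* y) refl (C (suc i)) (Γ (suc i) * Q))
             (cong (_* (Γ (suc i) * Q)) (sym β-last)))
    below : ∀ i → i ≤ d →
      p₀ (suc n) * δ₀ i + (α i * (Γ i * shift i (trailing (suc i)) n)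
        + β i * (Γ (suc i) * shift (suc i) (trailing (suc (suc i))) n)
        + γ i * conv p₀ (λ m → shift 1 (column m) i) n)
      ≡ Γ i * shift i (trailing (suc i)) (suc n)
    below zero _ = trans
      (cong₂ (λ x y → x * 1ℚ + (α 0 * (1ℚ * trailing 1 n) + β 0 * (γ 1 * 1ℚ * shift 1 (trailing 2) n) + γ 0 * y))
             (trailing-step 0 z≤n (suc n)) (conv-zero p₀ n))
      (solve 7 (λ α β γ₁ γ₀ t s r → (r :- α :* t :- β :* γ₁ :* s) :* con 1ℚ
                  :+ (α :* (con 1ℚ :* t) :+ β :* (γ₁ :* con 1ℚ :* s) :+ γ₀ :* con 0ℚ) := con 1ℚ :* r)
             refl (α 0) (β 0) (γ 1) (γ 0) (trailing 1 n) (shift 1 (trailing 2) n) (trailing 1 (suc n)))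
      where
      conv-zero : ∀ f n → conv f (λ m → 0ℚ) n ≡ 0ℚ
      conv-zero f zero = *-zeroʳ (f 0)
      conv-zero f (suc n) = cong₂ _+_ (*-zeroʳ (f 0)) (conv-zero _ n)
    -- The claim for the row above is expanded by `trailing-step`, shifted and read one exponent
    -- later; the diagonal and superdiagonal contributions then cancel.
    below (suc i) i<d = trans
      (cong (λ y → p₀ (suc n) * 0ℚ + (a * (Γ (suc i) * t) + b * (g′ * Γ (suc i) * s) + g * y))
            (trans (charPoly-conv-column n i (ℕ.<⇒≤ i<d))
                   (cong (Γ i *_) (shift-recurrence a (b * g′) (trailing-step (suc i) i<d) (suc i) (suc n)))))
      (solve 9 (λ p a b g g′ G t s r → p :* con 0ℚ :+ (a :* (g :* G :* t) :+ b :* (g′ :* (g :* G) :* s)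
                                         :+ g :* (G :* (r :- a :* t :- b :* g′ :* s))) := g :* G :* r)
             refl (p₀ (suc n)) a b g g′ (Γ i) t s (shift (suc i) (trailing (suc (suc i))) (suc n)))
      where
      a b g g′ t s : ℚ
      a = α (suc i)
      b = β (suc i)
      g = γ (suc i)
      g′ = γ (suc (suc i))
      t = shift (suc i) (trailing (suc (suc i))) n
      s = shift (suc (suc i)) (trailing (suc (suc (suc i)))) n

-- Integrality and a Fatou lemma

*-cancelˡ-nonZero : ∀ r {p q} → r ≢ 0ℚ → r * p ≡ r * q → p ≡ q
*-cancelˡ-nonZero r {p} {q} r≢0 eq = trans (sym (undo p)) (trans (cong (1/ r *_) eq) (undo q))
  where
  instance
    nz : NonZero r
    nz = ≢-nonZero r≢0
  undo : ∀ x → 1/ r * (r * x) ≡ x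
  undo x = trans (sym (*-assoc (1/ r) r x)) (trans (cong (_* x) (*-inverseˡ r)) (*-identityˡ x))

*-nonZero : ∀ {p q} → p ≢ 0ℚ → q ≢ 0ℚ → p * q ≢ 0ℚ
*-nonZero {p} p≢0 q≢0 eq = q≢0 (*-cancelˡ-nonZero p p≢0 (trans eq (sym (*-zeroʳ p))))

ι : ℤ → ℚ
ι z = z / 1

ι-+ : ∀ a b → ι (a ℤ.+ b) ≡ ι a + ι b
ι-+ a b = toℚᵘ-injective (begin-equality
  toℚᵘ (ι (a ℤ.+ b))               ≃⟨ toℚᵘ-fromℚᵘ (mkℚᵘ (a ℤ.+ b) 0) ⟩
  mkℚᵘ (a ℤ.+ b) 0                 ≃⟨ *≡* (solveℤ 2 (λ a b → (a :+ℤ b) :*ℤ conℤ (ℤ.+ 1) :=ℤ (a :*ℤ conℤ (ℤ.+ 1) :+ℤ b :*ℤ conℤ (ℤ.+ 1)) :*ℤ conℤ (ℤ.+ 1)) refl a b) ⟩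
  mkℚᵘ a 0 ℚᵘ.+ mkℚᵘ b 0           ≃⟨ ℚᵘ.+-cong (toℚᵘ-fromℚᵘ (mkℚᵘ a 0)) (toℚᵘ-fromℚᵘ (mkℚᵘ b 0)) ⟨
  toℚᵘ (ι a) ℚᵘ.+ toℚᵘ (ι b)       ≃⟨ toℚᵘ-homo-+ (ι a) (ι b) ⟨
  toℚᵘ (ι a + ι b)                 ∎)
  where
  open ℚᵘ.≤-Reasoning
  open ℤ-Solver renaming (solve to solveℤ; _:+_ to _:+ℤ_; _:*_ to _:*ℤ_; con to conℤ; _:=_ to _:=ℤ_)

ι-* : ∀ a b → ι (a ℤ.* b) ≡ ι a * ι b
ι-* a b = toℚᵘ-injective (begin-equality
  toℚᵘ (ι (a ℤ.* b))               ≃⟨ toℚᵘ-fromℚᵘ (mkℚᵘ (a ℤ.* b) 0) ⟩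
  mkℚᵘ a 0 ℚᵘ.* mkℚᵘ b 0           ≃⟨ ℚᵘ.*-cong (toℚᵘ-fromℚᵘ (mkℚᵘ a 0)) (toℚᵘ-fromℚᵘ (mkℚᵘ b 0)) ⟨
  toℚᵘ (ι a) ℚᵘ.* toℚᵘ (ι b)       ≃⟨ toℚᵘ-homo-* (ι a) (ι b) ⟨
  toℚᵘ (ι a * ι b)                 ∎)
  where open ℚᵘ.≤-Reasoning

ι-injective : ∀ {a b} → ι a ≡ ι b → a ≡ b
ι-injective {a} {b} eq with /-injective-≃ (mkℚᵘ a 0) (mkℚᵘ b 0) eq
... | *≡* eq′ = trans (sym (ℤ.*-identityʳ a)) (trans eq′ (ℤ.*-identityʳ b))

ι-*-/ : ∀ n k → ι (ℤ.+ suc k) * (n / suc k) ≡ ι n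
ι-*-/ n k = toℚᵘ-injective (begin-equality
  toℚᵘ (ι (ℤ.+ suc k) * (n / suc k))            ≃⟨ toℚᵘ-homo-* (ι (ℤ.+ suc k)) (n / suc k) ⟩
  toℚᵘ (ι (ℤ.+ suc k)) ℚᵘ.* toℚᵘ (n / suc k)    ≃⟨ ℚᵘ.*-cong (toℚᵘ-fromℚᵘ (mkℚᵘ (ℤ.+ suc k) 0)) (toℚᵘ-fromℚᵘ (mkℚᵘ n k)) ⟩
  mkℚᵘ (ℤ.+ suc k) 0 ℚᵘ.* mkℚᵘ n k              ≃⟨ *≡* (trans (ℤ.*-identityʳ _) (trans (ℤ.*-comm (ℤ.+ suc k) n) (cong (λ m → n ℤ.* (ℤ.+ m)) (sym (ℕ.+-identityʳ (suc k)))))) ⟩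
  mkℚᵘ n 0                                      ≃⟨ toℚᵘ-fromℚᵘ (mkℚᵘ n 0) ⟨
  toℚᵘ (ι n)                                    ∎)
  where open ℚᵘ.≤-Reasoning

IsInt : ℚ → Set
IsInt q = ∃ λ z → q ≡ z / 1

isInt-+ : ∀ {p q} → IsInt p → IsInt q → IsInt (p + q)
isInt-+ (a , refl) (b , refl) = a ℤ.+ b , sym (ι-+ a b)

isInt-* : ∀ {p q} → IsInt p → IsInt q → IsInt (p * q)
isInt-* (a , refl) (b , refl) = a ℤ.* b , sym (ι-* a b)

denominator : ∀ q → ∃ λ N → N ≢ ℤ.0ℤ × IsInt (ι N * q)
denominator q = ℤ.+ ↧ₙ q , (λ ()) ,
  (↥ q , trans (cong (ι (ℤ.+ ↧ₙ q) *_) (sym (↥p/↧p≡p q))) (ι-*-/ (↥ q) (ℚ.denominator-1 q)))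

ι-nonZero : ∀ {a} → a ≢ ℤ.0ℤ → ι a ≢ 0ℚ
ι-nonZero a≢0 eq = a≢0 (ι-injective eq)

common-denominator : ∀ m (f : ℕ → ℚ) → ∃ λ N → N ≢ ℤ.0ℤ × (∀ j → j < m → IsInt (ι N * f j))
common-denominator zero f = ℤ.+ 1 , (λ ()) , (λ j ())
common-denominator (suc m) f with denominator (f 0) | common-denominator m (λ j → f (suc j))
... | M , M≢0 , intM | N , N≢0 , intN = M ℤ.* N ,
  (λ eq → *-nonZero (ι-nonZero M≢0) (ι-nonZero N≢0) (trans (sym (ι-* M N)) (cong ι eq))) , both
  where
  both : ∀ j → j < suc m → IsInt (ι (M ℤ.* N) * f j)
  both zero _ = subst IsInt
    (trans (solve 3 (λ m n f → n :* (m :* f) := (m :* n) :* f) refl (ι M) (ι N) (f 0)) (cong (_* f 0) (sym (ι-* M N))))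
    (isInt-* (N , refl) intM)
  both (suc j) (s≤s j<m) = subst IsInt
    (trans (sym (*-assoc (ι M) (ι N) (f (suc j)))) (cong (_* f (suc j)) (sym (ι-* M N))))
    (isInt-* (M , refl) (intN j j<m))

convℤ : (ℕ → ℤ) → (ℕ → ℤ) → ℕ → ℤ
convℤ f y zero = f 0 ℤ.* y 0
convℤ f y (suc n) = f 0 ℤ.* y (suc n) ℤ.+ convℤ (λ s → f (suc s)) y n

convℤ-*ˡ : ∀ f g y p → (∀ s → f s ≡ g s ℤ.* p) → ∀ n → convℤ f y n ≡ convℤ g y n ℤ.* p
convℤ-*ˡ f g y p eq zero = trans (cong (ℤ._* y 0) (eq 0))
  (solve′ 3 (λ g p y → (g :*′ p) :*′ y :=′ (g :*′ y) :*′ p) refl (g 0) p (y 0))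
  where open ℤ-Solver renaming (solve to solve′; _:*_ to _:*′_; _:=_ to _:=′_)
convℤ-*ˡ f g y p eq (suc n) = trans
  (cong₂ ℤ._+_ (cong (ℤ._* y (suc n)) (eq 0)) (convℤ-*ˡ (λ s → f (suc s)) (λ s → g (suc s)) y p (λ s → eq (suc s)) n))
  (solve′ 4 (λ g p y c → (g :*′ p) :*′ y :+′ c :*′ p :=′ (g :*′ y :+′ c) :*′ p) refl (g 0) p (y (suc n)) (convℤ (λ s → g (suc s)) y n))
  where open ℤ-Solver renaming (solve to solve′; _:+_ to _:+′_; _:*_ to _:*′_; _:=_ to _:=′_)

convℤ-*ʳ : ∀ f y z p → (∀ s → y s ≡ z s ℤ.* p) → ∀ n → convℤ f y n ≡ convℤ f z n ℤ.* p
convℤ-*ʳ f y z p eq zero = trans (cong (f 0 ℤ.*_) (eq 0)) (sym (ℤ.*-assoc (f 0) (z 0) p))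
convℤ-*ʳ f y z p eq (suc n) = trans
  (cong₂ ℤ._+_ (cong (f 0 ℤ.*_) (eq (suc n))) (convℤ-*ʳ (λ s → f (suc s)) y z p eq n))
  (solve′ 4 (λ f p y c → f :*′ (y :*′ p) :+′ c :*′ p :=′ (f :*′ y :+′ c) :*′ p) refl (f 0) p (z (suc n)) (convℤ (λ s → f (suc s)) z n))
  where open ℤ-Solver renaming (solve to solve′; _:+_ to _:+′_; _:*_ to _:*′_; _:=_ to _:=′_)

∣-convℤ : ∀ {p} f y n → (∀ i → i ≤ n → p ∣ y i) → p ∣ convℤ f y n
∣-convℤ f y zero h = ∣n⇒∣m*n (f 0) (h 0 z≤n)
∣-convℤ f y (suc n) h = ∣m∣n⇒∣m+n (∣n⇒∣m*n (f 0) (h (suc n) ℕ.≤-refl))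
  (∣-convℤ (λ s → f (suc s)) y n (λ i i≤n → h i (ℕ.m≤n⇒m≤1+n i≤n)))

prime-∣-* : ∀ {p} → Prime p → ∀ a b → ℤ.+ p ∣ a ℤ.* b → ℤ.+ p ∣ a ⊎ ℤ.+ p ∣ b
prime-∣-* pp a b p∣ab with euclidsLemma ℤ.∣ a ∣ ℤ.∣ b ∣ pp (subst (_ ℕ.∣_) (ℤ.abs-* a b) (∣⇒∣ᵤ p∣ab))
... | inj₁ p∣a = inj₁ (∣ᵤ⇒∣ p∣a)
... | inj₂ p∣b = inj₂ (∣ᵤ⇒∣ p∣b)

-- Gauss's lemma: only f has to be a polynomial, so y may be a power series.
gauss : ∀ {p} → Prime p → ∀ L f y → (∀ s → L ≤ s → f s ≡ ℤ.0ℤ) → (∀ n → ℤ.+ p ∣ convℤ f y n) →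
        (∀ s → ℤ.+ p ∣ f s) ⊎ (∀ n → ℤ.+ p ∣ y n)
gauss pp zero f y fin div = inj₁ (λ s → divides ℤ.0ℤ (fin s z≤n))
gauss {p} pp (suc L) f y fin div with ℤ.+ p ∣? f 0
... | yes p∣f₀ with gauss pp L (λ s → f (suc s)) y (λ s L≤s → fin (suc s) (s≤s L≤s))
                    (λ n → ∣m+n∣m⇒∣n (div (suc n)) (∣m⇒∣m*n (y (suc n)) p∣f₀))
...   | inj₁ p∣f = inj₁ λ { zero → p∣f₀ ; (suc s) → p∣f s }
...   | inj₂ p∣y = inj₂ p∣y
-- By induction every other term of the n-th coefficient is divisible by p, so p divides f 0 · y n
-- and, not dividing `f 0`, divides y n.
gauss {p} pp (suc L) f y fin div | no p∤f₀ = inj₂ (λ n → below n n ℕ.≤-refl)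
  where
  cancel : ∀ i → ℤ.+ p ∣ f 0 ℤ.* y i → ℤ.+ p ∣ y i
  cancel i h with prime-∣-* pp (f 0) (y i) h
  ... | inj₁ p∣f₀ = contradiction p∣f₀ p∤f₀
  ... | inj₂ p∣y = p∣y
  below : ∀ n i → i ≤ n → ℤ.+ p ∣ y i
  below zero .zero z≤n = cancel 0 (div 0)
  below (suc n) i i≤1+n with ℕ.m≤n⇒m<n∨m≡n i≤1+n
  ... | inj₁ (s≤s i≤n) = below n i i≤n
  ... | inj₂ refl = cancel (suc n) (∣m+n∣n⇒∣m (div (suc n)) (∣-convℤ (λ s → f (suc s)) y n (below n)))

-- By `gauss`, each prime of the constant product divides all of `f` or all of `y` and can be
-- divided out there; in the first case `f 0` and `f s` lose the same factor, so divisibility is not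
-- affected. With no prime left, f 0 · y 0 = ±1 and `f 0` is a unit.
primitive-denominator : ∀ ps → All Prime ps → ∀ L f y → (∀ s → L ≤ s → f s ≡ ℤ.0ℤ) →
  ℤ.∣ convℤ f y 0 ∣ ≡ product ps → (∀ n → convℤ f y (suc n) ≡ ℤ.0ℤ) → ∀ s → f 0 ∣ f s
primitive-denominator [] [] L f y fin head tail s =
  ∣ᵤ⇒∣ (subst (ℕ._∣ ℤ.∣ f s ∣) (sym (ℕ.m*n≡1⇒m≡1 ℤ.∣ f 0 ∣ ℤ.∣ y 0 ∣ (trans (sym (ℤ.abs-* (f 0) (y 0))) head))) (ℕ.1∣ _))
primitive-denominator (p ∷ ps) (pp ∷ pps) L f y fin head tail s with gauss pp L f y fin all
  where
  all : ∀ n → ℤ.+ p ∣ convℤ f y n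
  all zero = ∣ᵤ⇒∣ (ℕ.divides (product ps) (trans head (ℕ.*-comm p (product ps))))
  all (suc n) = divides ℤ.0ℤ (tail n)
... | inj₁ p∣f = subst₂ _∣_ (sym (eq 0)) (sym (eq s)) (mono (primitive-denominator ps pps L g y gfin ghead gtail s))
  where
  instance
    nz : ℕ.NonZero p
    nz = prime⇒nonZero pp
    nzℤ : ℤ.NonZero (ℤ.+ p)
    nzℤ = nz
  g : ℕ → ℤ
  g s = _∣_.quotient (p∣f s)
  eq : ∀ s → f s ≡ g s ℤ.* ℤ.+ p
  eq s = _∣_.equality (p∣f s)
  mono : ∀ {a b} → a ∣ b → a ℤ.* ℤ.+ p ∣ b ℤ.* ℤ.+ p
  mono {a} (divides q refl) = divides q (ℤ.*-assoc q a (ℤ.+ p))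
  gfin : ∀ s → L ≤ s → g s ≡ ℤ.0ℤ
  gfin s L≤s = ℤ.*-cancelʳ-≡ (g s) ℤ.0ℤ (ℤ.+ p) (trans (sym (eq s)) (fin s L≤s))
  ghead : ℤ.∣ convℤ g y 0 ∣ ≡ product ps
  ghead = ℕ.*-cancelʳ-≡ _ _ p (trans (sym (ℤ.abs-* (convℤ g y 0) (ℤ.+ p)))
    (trans (cong ℤ.∣_∣ (sym (convℤ-*ˡ f g y (ℤ.+ p) eq 0))) (trans head (ℕ.*-comm p (product ps)))))
  gtail : ∀ n → convℤ g y (suc n) ≡ ℤ.0ℤ
  gtail n = ℤ.*-cancelʳ-≡ _ ℤ.0ℤ (ℤ.+ p) (trans (sym (convℤ-*ˡ f g y (ℤ.+ p) eq (suc n))) (tail n))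
... | inj₂ p∣y = primitive-denominator ps pps L f z fin zhead ztail s
  where
  instance
    nz : ℕ.NonZero p
    nz = prime⇒nonZero pp
    nzℤ : ℤ.NonZero (ℤ.+ p)
    nzℤ = nz
  z : ℕ → ℤ
  z s = _∣_.quotient (p∣y s)
  eq : ∀ s → y s ≡ z s ℤ.* ℤ.+ p
  eq s = _∣_.equality (p∣y s)
  zhead : ℤ.∣ convℤ f z 0 ∣ ≡ product ps
  zhead = ℕ.*-cancelʳ-≡ _ _ p (trans (sym (ℤ.abs-* (convℤ f z 0) (ℤ.+ p)))
    (trans (cong ℤ.∣_∣ (sym (convℤ-*ʳ f y z (ℤ.+ p) eq 0))) (trans head (ℕ.*-comm p (product ps)))))
  ztail : ∀ n → convℤ f z (suc n) ≡ ℤ.0ℤ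
  ztail n = ℤ.*-cancelʳ-≡ _ ℤ.0ℤ (ℤ.+ p) (trans (sym (convℤ-*ʳ f y z (ℤ.+ p) eq (suc n))) (tail n))

ι-convℤ : ∀ {F Y : ℕ → ℤ} {f y} N K → (∀ s → N * f s ≡ ι (F s)) → (∀ n → K * y n ≡ ι (Y n)) →
          ∀ n → ι (convℤ F Y n) ≡ N * K * conv f y n
ι-convℤ {F} {Y} {f} {y} N K eqF eqY zero = trans (ι-* (F 0) (Y 0)) (trans (cong₂ _*_ (sym (eqF 0)) (sym (eqY 0)))
  (solve 4 (λ N K f y → (N :* f) :* (K :* y) := N :* K :* (f :* y)) refl N K (f 0) (y 0)))
ι-convℤ {F} {Y} {f} {y} N K eqF eqY (suc n) = trans (ι-+ (F 0 ℤ.* Y (suc n)) _) (trans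
  (cong₂ _+_ (trans (ι-* (F 0) (Y (suc n))) (cong₂ _*_ (sym (eqF 0)) (sym (eqY (suc n)))))
             (ι-convℤ N K (λ s → eqF (suc s)) eqY n))
  (solve 5 (λ N K f y c → (N :* f) :* (K :* y) :+ N :* K :* c := N :* K :* (f :* y :+ c)) refl N K (f 0) (y (suc n)) (conv (λ s → f (suc s)) y n)))

-- A Fatou lemma: if the power series y = g / f has bounded denominators, f is integral.
fatou : ∀ L (f y : Seq) g K → f 0 ≡ 1ℚ → (∀ s → L ≤ s → f s ≡ 0ℚ) → g ≢ 0ℚ → K ≢ ℤ.0ℤ →
        (∀ n → IsInt (ι K * y n)) → (∀ n → conv f y n ≡ g * δ₀ n) → ∀ s → IsInt (f s)
fatou L f y g K f₀≡1 fin g≢0 K≢0 yint eq s with common-denominator L f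
-- The integral multiple F = N f starts with F 0 = N because f 0 = 1, so `F₀∣Fs` says that N divides
-- N · f s in ℤ.
... | N , N≢0 , fint = q , *-cancelˡ-nonZero (ι N) (ι-nonZero N≢0)
    (trans (Feq s) (trans (cong ι (_∣_.equality F₀∣Fs)) (trans (cong (λ a → ι (q ℤ.* a)) F₀≡N)
    (trans (ι-* q N) (*-comm (ι q) (ι N))))))
  where
  intF : ∀ s → IsInt (ι N * f s)
  intF s with s ℕ.<? L
  ... | yes s<L = fint s s<L
  ... | no s≮L = ℤ.0ℤ , trans (cong (ι N *_) (fin s (ℕ.≮⇒≥ s≮L))) (*-zeroʳ (ι N))
  F Y : ℕ → ℤ
  F s = proj₁ (intF s)
  Y n = proj₁ (yint n)
  Feq : ∀ s → ι N * f s ≡ ι (F s)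
  Feq s = proj₂ (intF s)
  F₀≡N : F 0 ≡ N
  F₀≡N = ι-injective (trans (sym (Feq 0)) (trans (cong (ι N *_) f₀≡1) (*-identityʳ (ι N))))
  value : ∀ n → ι (convℤ F Y n) ≡ ι N * ι K * (g * δ₀ n)
  value n = trans (ι-convℤ (ι N) (ι K) Feq (λ n → proj₂ (yint n)) n) (cong (ι N * ι K *_) (eq n))
  head≢0 : ℤ.∣ convℤ F Y 0 ∣ ≢ 0
  head≢0 e = *-nonZero (*-nonZero (ι-nonZero N≢0) (ι-nonZero K≢0)) (*-nonZero {q = 1ℚ} g≢0 (λ ()))
    (trans (sym (value 0)) (cong ι (ℤ.∣i∣≡0⇒i≡0 {convℤ F Y 0} e)))
  instance
    nz : ℕ.NonZero ℤ.∣ convℤ F Y 0 ∣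
    nz = ℕ.≢-nonZero head≢0
  open PrimeFactorisation (factorise ℤ.∣ convℤ F Y 0 ∣)
  F₀∣Fs : F 0 ∣ F s
  F₀∣Fs = primitive-denominator factors factorsPrime L F Y
    (λ s L≤s → ι-injective (trans (sym (Feq s)) (trans (cong (ι N *_) (fin s L≤s)) (*-zeroʳ (ι N)))))
    isFactorisation
    (λ n → ι-injective (trans (value (suc n)) (trans (cong (ι N * ι K *_) (*-zeroʳ g)) (*-zeroʳ (ι N * ι K)))))
    s
  q : ℤ
  q = _∣_.quotient F₀∣Fs

-- The Grover walk on a regular graph

⟦_⟧ : Bool → ℚ
⟦ b ⟧ = if b then 1ℚ else 0ℚ

if-⟦⟧ : ∀ b x → (if b then x else 0ℚ) ≡ ⟦ b ⟧ * x
if-⟦⟧ true x = sym (*-identityˡ x)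
if-⟦⟧ false x = sym (*-zeroˡ x)

⟦⟧-∧ : ∀ b b′ → ⟦ b ∧ b′ ⟧ ≡ ⟦ b ⟧ * ⟦ b′ ⟧
⟦⟧-∧ true b′ = sym (*-identityˡ ⟦ b′ ⟧)
⟦⟧-∧ false b′ = sym (*-zeroˡ ⟦ b′ ⟧)

⟦⟧-idem : ∀ b → ⟦ b ⟧ * ⟦ b ⟧ ≡ ⟦ b ⟧
⟦⟧-idem true = refl
⟦⟧-idem false = refl

sum-zero : ∀ {n} {f : Fin n → ℚ} → (∀ i → f i ≡ 0ℚ) → sum f ≡ 0ℚ
sum-zero {zero} z = refl
sum-zero {suc n} z = cong₂ _+_ (z fzero) (sum-zero (λ i → z (fsuc i)))

sum-difference : ∀ {n} (f g : Fin n → ℚ) x → sum (λ i → x * f i - g i) ≡ x * sum f - sum g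
sum-difference {zero} f g x = solve 1 (λ x → con 0ℚ := x :* con 0ℚ :- con 0ℚ) refl x
sum-difference {suc n} f g x = trans (cong (x * f fzero - g fzero +_) (sum-difference (λ i → f (fsuc i)) (λ i → g (fsuc i)) x))
  (solve 5 (λ x a b c d → x :* a :- b :+ (x :* c :- d) := x :* (a :+ c) :- (b :+ d)) refl
         x (f fzero) (g fzero) (sum (λ i → f (fsuc i))) (sum (λ i → g (fsuc i))))

sum-pick : ∀ {n} (u : Fin n) f → sum (λ x → ⟦ x =ᶠ u ⟧ * f x) ≡ f u
sum-pick fzero f = trans (cong₂ _+_ (*-identityˡ (f fzero)) (sum-zero (λ i → *-zeroˡ (f (fsuc i))))) (+-identityʳ (f fzero))
sum-pick (fsuc u) f = trans (cong₂ _+_ (*-zeroˡ (f fzero)) (sum-pick u (λ x → f (fsuc x)))) (+-identityˡ (f (fsuc u)))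

≡ᵇ-sym : ∀ m n → (m ≡ᵇ n) ≡ (n ≡ᵇ m)
≡ᵇ-sym zero zero = refl
≡ᵇ-sym zero (suc n) = refl
≡ᵇ-sym (suc m) zero = refl
≡ᵇ-sym (suc m) (suc n) = ≡ᵇ-sym m n

=ᶠ⇒≡ : ∀ {n} (u v : Fin n) → (u =ᶠ v) ≡ true → u ≡ v
=ᶠ⇒≡ fzero fzero eq = refl
=ᶠ⇒≡ (fsuc u) (fsuc v) eq = cong fsuc (=ᶠ⇒≡ u v eq)

foldr-map-tabulate : ∀ {A : Set} {n} (f : A → ℚ) (g : Fin n → A) z →
  foldr _+_ z (map f (tabulate g)) ≡ sum (λ i → f (g i)) + z
foldr-map-tabulate {n = zero} f g z = sym (+-identityˡ z)
foldr-map-tabulate {n = suc n} f g z = trans (cong (f (g fzero) +_) (foldr-map-tabulate f (λ i → g (fsuc i)) z))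
  (sym (+-assoc (f (g fzero)) _ z))

foldr-concatMap-tabulate : ∀ {A : Set} {m n} (f : A → Fin n → ℚ) (g : Fin m → A) →
  foldr _+_ 0ℚ (concatMap (λ u → map (f u) (allFin n)) (tabulate g)) ≡ sum (λ i → sum (f (g i)))
foldr-concatMap-tabulate {m = zero} f g = refl
foldr-concatMap-tabulate {m = suc m} {n} f g = trans (foldr-++ _+_ 0ℚ (map (f (g fzero)) (allFin n)) _)
  (trans (foldr-map-tabulate (f (g fzero)) (λ i → i) _)
         (cong (sum (f (g fzero)) +_) (foldr-concatMap-tabulate f (λ i → g (fsuc i)))))

count-tabulate : ∀ {m n} (p : Fin n → Bool) (g : Fin m → Fin n) →
  ι (ℤ.+ foldr (λ i acc → if p i then suc acc else acc) 0 (tabulate g)) ≡ sum (λ i → ⟦ p (g i) ⟧)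
count-tabulate {zero} p g = refl
count-tabulate {suc m} p g with p (g fzero)
... | true = trans (ι-+ (ℤ.+ 1) (ℤ.+ foldr (λ i acc → if p i then suc acc else acc) 0 (tabulate (λ i → g (fsuc i))))) (cong (1ℚ +_) (count-tabulate p (λ i → g (fsuc i))))
... | false = trans (count-tabulate p (λ i → g (fsuc i))) (sym (+-identityˡ _))

count-sum : ∀ {n} (p : Fin n → Bool) → ι (ℤ.+ count p) ≡ sum (λ i → ⟦ p i ⟧)
count-sum p = count-tabulate p (λ i → i)

count-nonZero : ∀ {n} (p : Fin n → Bool) z → p z ≡ true → count p ≢ 0
count-nonZero p z pz = go (λ i → i) z pz
  where
  go : ∀ {m} (g : Fin m → _) z → p (g z) ≡ true → foldr (λ i acc → if p i then suc acc else acc) 0 (tabulate g) ≢ 0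
  go g fzero pz eq rewrite pz with () ← eq
  go g (fsuc z) pz eq with p (g fzero)
  ... | true with () ← eq
  ... | false = go (λ i → g (fsuc i)) z pz eq

anyFin-intro : ∀ {n} (p : Fin n → Bool) z → p z ≡ true → anyFin p ≡ true
anyFin-intro p z pz = go (λ i → i) z pz
  where
  go : ∀ {m} (g : Fin m → _) z → p (g z) ≡ true → foldr (λ i acc → p i ∨ acc) false (tabulate g) ≡ true
  go g fzero pz rewrite pz = refl
  go g (fsuc z) pz with p (g fzero)
  ... | true = refl
  ... | false = go (λ i → g (fsuc i)) z pz

anyFin-elim : ∀ {n} (p : Fin n → Bool) → anyFin p ≡ true → ∃ λ z → p z ≡ true
anyFin-elim p = go (λ i → i)
  where
  go : ∀ {m} (g : Fin m → _) → foldr (λ i acc → p i ∨ acc) false (tabulate g) ≡ true → ∃ λ z → p z ≡ true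
  go {suc m} g eq with p (g fzero) in pg
  ... | true = g fzero , pg
  ... | false = go (λ i → g (fsuc i)) eq

sumArcs-sum : ∀ {n} (adj : Graph n) f → sumArcs adj f ≡ sum (λ u → sum (λ v → ⟦ adj u v ⟧ * f (u , v)))
sumArcs-sum adj f = trans (foldr-concatMap-tabulate (λ u v → if adj u v then f (u , v) else 0ℚ) (λ i → i))
  (sum-cong-≗ (λ u → sum-cong-≗ (λ v → if-⟦⟧ (adj u v) (f (u , v)))))

ι-*-divℕ : ∀ m k → ι (ℤ.+ suc k) * divℕ m (suc k) ≡ ι (ℤ.+ m)
ι-*-divℕ m k = ι-*-/ (ℤ.+ m) k

isInt-*-+ : ∀ K {p q} → IsInt (ι K * p) → IsInt (ι K * q) → IsInt (ι K * (p + q))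
isInt-*-+ K {p} {q} x y = subst IsInt (sym (*-distribˡ-+ (ι K) p q)) (isInt-+ x y)

module RegularGraph {n : ℕ} (adj : Graph n) (k : ℕ) (symmetric : ∀ u v → adj u v ≡ adj v u)
                    (regular : ∀ v → deg adj v ≡ suc k) where

  τ : ℚ
  τ = divℕ 2 (suc k)

  adjacency : (Fin n → ℚ) → Fin n → ℚ
  adjacency g u = sum (λ w → ⟦ adj w u ⟧ * g w)

  X : (Fin n → ℚ) → Fin n → ℚ
  X g u = τ * adjacency g u

  X^ : ℕ → (Fin n → ℚ) → Fin n → ℚ
  X^ zero g = g
  X^ (suc i) g = X (X^ i g)

  X^-suc : ∀ i g → X^ (suc i) g ≡ X^ i (X g)
  X^-suc zero g = refl
  X^-suc (suc i) g = cong X (X^-suc i g)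

  X-cong : ∀ {g h} → (∀ u → g u ≡ h u) → ∀ u → X g u ≡ X h u
  X-cong eq u = cong (τ *_) (sum-cong-≗ (λ w → cong (⟦ adj w u ⟧ *_) (eq w)))

  X^-cong : ∀ i {g h} → (∀ u → g u ≡ h u) → ∀ u → X^ i g u ≡ X^ i h u
  X^-cong zero eq = eq
  X^-cong (suc i) eq = X-cong (X^-cong i eq)

  X^-+ : ∀ i g h u → X^ i (λ v → g v + h v) u ≡ X^ i g u + X^ i h u
  X^-+ zero g h u = refl
  X^-+ (suc i) g h u = begin
    X (X^ i (λ v → g v + h v)) u                              ≡⟨ X-cong (X^-+ i g h) u ⟩
    τ * sum (λ w → ⟦ adj w u ⟧ * (X^ i g w + X^ i h w))       ≡⟨ cong (τ *_) (trans (sum-cong-≗ (λ w → *-distribˡ-+ ⟦ adj w u ⟧ (X^ i g w) (X^ i h w))) (∑-distrib-+ (λ w → ⟦ adj w u ⟧ * X^ i g w) (λ w → ⟦ adj w u ⟧ * X^ i h w))) ⟩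
    τ * (adjacency (X^ i g) u + adjacency (X^ i h) u)         ≡⟨ *-distribˡ-+ τ _ _ ⟩
    X (X^ i g) u + X (X^ i h) u                               ∎
    where open ≡-Reasoning

  degree-sum : ∀ u → sum (λ w → ⟦ adj w u ⟧) ≡ ι (ℤ.+ suc k)
  degree-sum u = trans (sum-cong-≗ (λ w → cong ⟦_⟧ (symmetric w u))) (trans (sym (count-sum (adj u))) (cong (λ m → ι (ℤ.+ m)) (regular u)))

  grover-entry : ∀ u v w x → grover adj (u , v) (w , x) ≡ ⟦ x =ᶠ u ⟧ * (τ - ⟦ v =ᶠ w ⟧)
  grover-entry u v w x rewrite regular x with x =ᶠ u | v =ᶠ w
  ... | true  | true  = sym (*-identityˡ (τ - 1ℚ))
  ... | true  | false = solve 1 (λ t → t := con 1ℚ :* (t :- con 0ℚ)) refl τ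
  ... | false | b     = sym (*-zeroˡ (τ - ⟦ b ⟧))

  module Orbit (f : Arc n) where

    -- The column of Uʲ at `f`, that is, Uʲ applied to the indicator of `f`. It is defined on all
    -- pairs of vertices, so sums over arcs carry a weight such as `⟦ adj w u ⟧`.
    ψ : ℕ → Arc n → ℚ
    ψ j e = powArc adj (grover adj) j e f

    incoming outgoing : ℕ → Fin n → ℚ
    incoming j u = sum (λ w → ⟦ adj w u ⟧ * ψ j (w , u))
    outgoing j u = sum (λ w → ⟦ adj w u ⟧ * ψ j (u , w))

    -- Only arcs ending at `u` meet the row of `(u , v)`, each with weight `τ`, and the reversed arc
    -- loses 1. The identity holds for non-arcs as well, hence the factor `⟦ adj v u ⟧`.
    ψ-suc : ∀ j u v → ψ (suc j) (u , v) ≡ τ * incoming j u - ⟦ adj v u ⟧ * ψ j (v , u)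
    ψ-suc j u v = begin
      ψ (suc j) (u , v)
        ≡⟨ sumArcs-sum adj (λ e → grover adj (u , v) e * ψ j e) ⟩
      sum (λ w → sum (λ x → ⟦ adj w x ⟧ * (grover adj (u , v) (w , x) * ψ j (w , x))))
        ≡⟨ sum-cong-≗ (λ w → trans (sum-cong-≗ (λ x → entry w x)) (sum-pick u (λ x → (τ - ⟦ v =ᶠ w ⟧) * (⟦ adj w x ⟧ * ψ j (w , x))))) ⟩
      sum (λ w → (τ - ⟦ v =ᶠ w ⟧) * (⟦ adj w u ⟧ * ψ j (w , u)))
        ≡⟨ sum-cong-≗ (λ w → trans (solve 3 (λ t b y → (t :- b) :* y := t :* y :- b :* y) refl τ ⟦ v =ᶠ w ⟧ (⟦ adj w u ⟧ * ψ j (w , u)))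
                                   (cong (λ b → τ * (⟦ adj w u ⟧ * ψ j (w , u)) - ⟦ b ⟧ * (⟦ adj w u ⟧ * ψ j (w , u))) (≡ᵇ-sym (toℕ v) (toℕ w)))) ⟩
      sum (λ w → τ * (⟦ adj w u ⟧ * ψ j (w , u)) - ⟦ w =ᶠ v ⟧ * (⟦ adj w u ⟧ * ψ j (w , u)))
        ≡⟨ sum-difference (λ w → ⟦ adj w u ⟧ * ψ j (w , u)) (λ w → ⟦ w =ᶠ v ⟧ * (⟦ adj w u ⟧ * ψ j (w , u))) τ ⟩
      τ * incoming j u - sum (λ w → ⟦ w =ᶠ v ⟧ * (⟦ adj w u ⟧ * ψ j (w , u)))
        ≡⟨ cong (λ s → τ * incoming j u - s) (sum-pick v (λ w → ⟦ adj w u ⟧ * ψ j (w , u))) ⟩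
      τ * incoming j u - ⟦ adj v u ⟧ * ψ j (v , u)  ∎
      where
      open ≡-Reasoning
      entry : ∀ w x → ⟦ adj w x ⟧ * (grover adj (u , v) (w , x) * ψ j (w , x))
                    ≡ ⟦ x =ᶠ u ⟧ * ((τ - ⟦ v =ᶠ w ⟧) * (⟦ adj w x ⟧ * ψ j (w , x)))
      entry w x = trans (cong (λ g → ⟦ adj w x ⟧ * (g * ψ j (w , x))) (grover-entry u v w x))
        (solve 4 (λ a b t y → a :* ((b :* t) :* y) := b :* (t :* (a :* y))) refl ⟦ adj w x ⟧ ⟦ x =ᶠ u ⟧ (τ - ⟦ v =ᶠ w ⟧) (ψ j (w , x)))

    incoming-suc : ∀ j u → incoming (suc j) u ≡ X (incoming j) u - outgoing j u
    incoming-suc j u = trans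
      (sum-cong-≗ (λ w → trans (cong (⟦ adj w u ⟧ *_) (ψ-suc j w u))
        (trans (solve 5 (λ a t i b y → a :* (t :* i :- b :* y) := t :* (a :* i) :- (a :* b) :* y) refl ⟦ adj w u ⟧ τ (incoming j w) ⟦ adj u w ⟧ (ψ j (u , w)))
               (cong (λ a → τ * (⟦ adj w u ⟧ * incoming j w) - a * ψ j (u , w))
                     (trans (cong (λ b → ⟦ adj w u ⟧ * ⟦ b ⟧) (symmetric u w)) (⟦⟧-idem (adj w u)))))))
      (sum-difference (λ w → ⟦ adj w u ⟧ * incoming j w) (λ w → ⟦ adj w u ⟧ * ψ j (u , w)) τ)

    -- Regularity enters here: degree times `τ` is 2, so the averaging part gives `incoming j u`
    -- twice and the reversal removes it once.
    outgoing-suc : ∀ j u → outgoing (suc j) u ≡ incoming j u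
    outgoing-suc j u = begin
      outgoing (suc j) u
        ≡⟨ sum-cong-≗ (λ w → trans (cong (⟦ adj w u ⟧ *_) (ψ-suc j u w))
             (trans (solve 4 (λ a t i y → a :* (t :* i :- a :* y) := (t :* i) :* a :- (a :* a) :* y) refl ⟦ adj w u ⟧ τ (incoming j u) (ψ j (w , u)))
                    (cong (λ a → (τ * incoming j u) * ⟦ adj w u ⟧ - a * ψ j (w , u)) (⟦⟧-idem (adj w u))))) ⟩
      sum (λ w → (τ * incoming j u) * ⟦ adj w u ⟧ - ⟦ adj w u ⟧ * ψ j (w , u))
        ≡⟨ sum-difference (λ w → ⟦ adj w u ⟧) (λ w → ⟦ adj w u ⟧ * ψ j (w , u)) (τ * incoming j u) ⟩
      (τ * incoming j u) * sum (λ w → ⟦ adj w u ⟧) - incoming j u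
        ≡⟨ cong (λ s → (τ * incoming j u) * s - incoming j u) (degree-sum u) ⟩
      (τ * incoming j u) * ι (ℤ.+ suc k) - incoming j u
        ≡⟨ solve 3 (λ t i k → (t :* i) :* k :- i := (k :* t) :* i :- i) refl τ (incoming j u) (ι (ℤ.+ suc k)) ⟩
      (ι (ℤ.+ suc k) * τ) * incoming j u - incoming j u
        ≡⟨ cong (λ s → s * incoming j u - incoming j u) (ι-*-divℕ 2 k) ⟩
      2ℚ * incoming j u - incoming j u
        ≡⟨ solve 1 (λ i → (con 1ℚ :+ con 1ℚ) :* i :- i := i) refl (incoming j u) ⟩
      incoming j u ∎
      where open ≡-Reasoning

    X-incoming : ∀ j u → X (incoming (suc j)) u ≡ incoming (suc (suc j)) u + incoming j u
    X-incoming j u = trans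
      (solve 2 (λ x o → x := (x :- o) :+ o) refl (X (incoming (suc j)) u) (outgoing (suc j) u))
      (cong₂ _+_ (sym (incoming-suc (suc j) u)) (outgoing-suc j u))

    module _ (m : ℕ) (period : ∀ e → IsArc adj e → ψ (suc m) e ≡ ψ 0 e) where

      -- The period is known on arcs only, hence the weight. `ψ-suc` expresses each step through
      -- weighted values of the step before, so periodicity propagates by mutual induction with
      -- `incoming-periodic`.
      ψ-periodic : ∀ j u v → ⟦ adj u v ⟧ * ψ (j ℕ.+ suc m) (u , v) ≡ ⟦ adj u v ⟧ * ψ j (u , v)
      incoming-periodic : ∀ j u → incoming (j ℕ.+ suc m) u ≡ incoming j u

      ψ-periodic zero u v with adj u v in uv
      ... | true = cong (1ℚ *_) (period (u , v) uv)
      ... | false = trans (*-zeroˡ (ψ (suc m) (u , v))) (sym (*-zeroˡ (ψ 0 (u , v))))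
      ψ-periodic (suc j) u v = cong (⟦ adj u v ⟧ *_) (begin
        ψ (suc j ℕ.+ suc m) (u , v)                                            ≡⟨ ψ-suc (j ℕ.+ suc m) u v ⟩
        τ * incoming (j ℕ.+ suc m) u - ⟦ adj v u ⟧ * ψ (j ℕ.+ suc m) (v , u)   ≡⟨ cong₂ (λ x y → τ * x - y) (incoming-periodic j u) (ψ-periodic j v u) ⟩
        τ * incoming j u - ⟦ adj v u ⟧ * ψ j (v , u)                           ≡⟨ ψ-suc j u v ⟨
        ψ (suc j) (u , v)                                                      ∎)
        where open ≡-Reasoning
      incoming-periodic j u = sum-cong-≗ (λ w → ψ-periodic j w u)

      incoming-mod : ∀ r t u → incoming (r ℕ.+ t ℕ.* suc m) u ≡ incoming r u
      incoming-mod r zero u = cong (λ j → incoming j u) (ℕ.+-identityʳ r)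
      incoming-mod r (suc t) u = begin
        incoming (r ℕ.+ (suc m ℕ.+ t ℕ.* suc m)) u   ≡⟨ cong (λ j → incoming (r ℕ.+ j) u) (ℕ.+-comm (suc m) (t ℕ.* suc m)) ⟩
        incoming (r ℕ.+ (t ℕ.* suc m ℕ.+ suc m)) u   ≡⟨ cong (λ j → incoming j u) (ℕ.+-assoc r (t ℕ.* suc m) (suc m)) ⟨
        incoming (r ℕ.+ t ℕ.* suc m ℕ.+ suc m) u     ≡⟨ incoming-periodic (r ℕ.+ t ℕ.* suc m) u ⟩
        incoming (r ℕ.+ t ℕ.* suc m) u               ≡⟨ incoming-mod r t u ⟩
        incoming r u                                 ∎
        where open ≡-Reasoning

      power-recurrence : ∀ i j u → X^ (suc i) (incoming (suc j)) u ≡ X^ i (incoming (suc (suc j))) u + X^ i (incoming j) u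
      power-recurrence i j u = begin
        X^ (suc i) (incoming (suc j)) u                                 ≡⟨ cong (λ g → g u) (X^-suc i (incoming (suc j))) ⟩
        X^ i (X (incoming (suc j))) u                                   ≡⟨ X^-cong i (X-incoming j) u ⟩
        X^ i (λ u → incoming (suc (suc j)) u + incoming j u) u          ≡⟨ X^-+ i (incoming (suc (suc j))) (incoming j) u ⟩
        X^ i (incoming (suc (suc j))) u + X^ i (incoming j) u           ∎
        where open ≡-Reasoning

      module _ (v : Fin n) (K : ℤ) (integral : ∀ j → j < suc m → IsInt (ι K * incoming j v)) where

        -- The recurrence trades one power of `X` for a sum of two orbit functions. At i = 0 the
        -- index is reduced modulo the period to one of the finitely many values that `K` serves.
        power-integral : ∀ i j → IsInt (ι K * X^ i (incoming j) v)
        power-integral-suc : ∀ i j → IsInt (ι K * X^ (suc i) (incoming (suc j)) v)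

        power-integral zero j = subst (λ q → IsInt (ι K * q))
          (sym (trans (cong (λ j → incoming j v) (ℕ.m≡m%n+[m/n]*n j (suc m))) (incoming-mod (j ℕ.% suc m) (j ℕ./ suc m) v)))
          (integral (j ℕ.% suc m) (ℕ.m%n<n j (suc m)))
        power-integral (suc i) (suc j) = power-integral-suc i j
        -- The recurrence needs a positive orbit index; periodicity lets `suc m` stand for 0.
        power-integral (suc i) zero = subst (λ q → IsInt (ι K * q)) (X^-cong (suc i) (incoming-periodic 0) v) (power-integral-suc i m)
        power-integral-suc i j = subst (λ q → IsInt (ι K * q)) (sym (power-recurrence i j v))
          (isInt-*-+ K (power-integral i (suc (suc j))) (power-integral i j))

      bounded-denominators : ∀ v → ∃ λ K → K ≢ ℤ.0ℤ × (∀ i j → IsInt (ι K * X^ i (incoming j) v))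
      bounded-denominators v =
        let K , K≢0 , integral = common-denominator (suc m) (λ j → incoming j v)
        in K , K≢0 , power-integral v K integral

-- Distances and distance-regularity

module Distance {n : ℕ} (adj : Graph n) (x : Fin n) where

  ball-mono : ∀ j y → ball adj j x y ≡ true → ball adj (suc j) x y ≡ true
  ball-mono j y e rewrite e = refl

  ball-step : ∀ j z y → ball adj j x z ≡ true → adj z y ≡ true → ball adj (suc j) x y ≡ true
  ball-step j z y e e′ = trans
    (cong (ball adj j x y ∨_) (anyFin-intro (λ z → ball adj j x z ∧ adj z y) z (cong₂ _∧_ e e′)))
    (∨-zeroʳ (ball adj j x y))

  atDist-suc : ∀ j y → ball adj (suc j) x y ≡ true → ball adj j x y ≡ false → atDist adj (suc j) x y ≡ true
  atDist-suc j y e e′ = cong₂ (λ p q → p ∧ not q) e e′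

  atDist-tooFar : ∀ j y → ball adj (suc j) x y ≡ false → atDist adj (suc j) x y ≡ false
  atDist-tooFar j y e = cong (_∧ not (ball adj j x y)) e

  atDist-tooClose : ∀ j y → ball adj j x y ≡ true → atDist adj (suc j) x y ≡ false
  atDist-tooClose j y e = trans (cong (λ q → ball adj (suc j) x y ∧ not q) e) (∧-zeroʳ (ball adj (suc j) x y))

  ∧-not : ∀ p q → p ∧ not q ≡ true → p ≡ true × q ≡ false
  ∧-not true false e = refl , refl

  atDist-suc⁻¹ : ∀ j y → atDist adj (suc j) x y ≡ true → ball adj (suc j) x y ≡ true × ball adj j x y ≡ false
  atDist-suc⁻¹ j y = ∧-not (ball adj (suc j) x y) (ball adj j x y)

  atDist⇒ball : ∀ j y → atDist adj j x y ≡ true → ball adj j x y ≡ true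
  atDist⇒ball zero y e = e
  atDist⇒ball (suc j) y e = proj₁ (atDist-suc⁻¹ j y e)

  ball-contra : ∀ j z y → ball adj j x z ≡ true → adj z y ≡ true → ball adj (suc j) x y ≡ false → ∀ {A : Set} → A
  ball-contra j z y e e′ f with () ← trans (sym (ball-step j z y e e′)) f

  ∧-true : ∀ p q → p ∧ q ≡ true → p ≡ true × q ≡ true
  ∧-true true true e = refl , refl

  -- Since `y` enters only with ball j + 1, it has a neighbour in ball j; were that neighbour in a
  -- smaller ball, `y` would already lie in ball j.
  predecessor : ∀ j y → atDist adj (suc j) x y ≡ true → ∃ λ z → adj z y ≡ true × atDist adj j x z ≡ true
  predecessor j y e =
    let near , far = atDist-suc⁻¹ j y e
        z , h = anyFin-elim (λ z → ball adj j x z ∧ adj z y) (trans (sym (cong (_∨ anyFin (λ z → ball adj j x z ∧ adj z y)) far)) near)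
        zj , zy = ∧-true (ball adj j x z) (adj z y) h
    in z , zy , at j z y zj zy far
    where
    at : ∀ j z y → ball adj j x z ≡ true → adj z y ≡ true → ball adj j x y ≡ false → atDist adj j x z ≡ true
    at zero z y zj zy far = zj
    at (suc j) z y zj zy far = split refl
      where
      split : ∀ {b} → ball adj j x z ≡ b → atDist adj (suc j) x z ≡ true
      split {true} e = ball-contra j z y e zy far
      split {false} e = atDist-suc j z zj e

  geodesic : ∀ j y → atDist adj j x y ≡ true → ∀ i → i ≤ j → ∃ λ z → atDist adj i x z ≡ true
  geodesic j y e i i≤j with ℕ.m≤n⇒m<n∨m≡n i≤j
  ... | inj₂ refl = y , e
  geodesic (suc j) y e i i≤j | inj₁ (s≤s i≤j′) =
    let z , _ , e′ = predecessor j y e in geodesic j z e′ i i≤j′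

  -- The layer at distance i - 1, empty for i = 0, in accordance with `shift 1`.
  atBelow : ℕ → Fin n → Bool
  atBelow zero w = false
  atBelow (suc i) w = atDist adj i x w

  -- Each case fixes all three indicators that weight the terms of `apply`. `farther` also records
  -- that `w` is outside ball i, from which i < d will follow.
  data Position (i : ℕ) (w : Fin n) : Set where
    closer : atBelow i w ≡ true → atDist adj i x w ≡ false → atDist adj (suc i) x w ≡ false → Position i w
    level  : atBelow i w ≡ false → atDist adj i x w ≡ true → atDist adj (suc i) x w ≡ false → Position i w
    farther : atBelow i w ≡ false → atDist adj i x w ≡ false → atDist adj (suc i) x w ≡ true →
              ball adj i x w ≡ false → Position i w

  -- The triangle inequality in both directions: `w` lies in ball i + 1, and if it lay in ball i -
  -- 2, then `y` would lie in ball i - 1.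
  position : (∀ u v → adj u v ≡ adj v u) → ∀ i y w → atDist adj i x y ≡ true → adj w y ≡ true → Position i w
  position symmetric i y w yi wy = split i yi refl (ball-step i y w (atDist⇒ball i y yi) yw)
    where
    yw : adj y w ≡ true
    yw = trans (symmetric y w) wy
    split : ∀ i {b} → atDist adj i x y ≡ true → ball adj i x w ≡ b → ball adj (suc i) x w ≡ true → Position i w
    split zero {true} yi e e′ = level refl e (atDist-tooClose 0 w e)
    split zero {false} yi e e′ = farther refl e (atDist-suc 0 w e′ e) e
    split (suc i) {false} yi e e′ = farther (lower i e) (atDist-tooFar i w e) (atDist-suc (suc i) w e′ e) e
      where
      lower : ∀ i → ball adj (suc i) x w ≡ false → atDist adj i x w ≡ false
      lower i e with atDist adj i x w in e″
      ... | false = refl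
      ... | true with () ← trans (sym (ball-mono i w (atDist⇒ball i w e″))) e
    split (suc i) {true} yi e e′ = inner i (proj₂ (atDist-suc⁻¹ i y yi)) e refl
      where
      inner : ∀ i {b} → ball adj i x y ≡ false → ball adj (suc i) x w ≡ true → ball adj i x w ≡ b → Position (suc i) w
      inner i {false} far e f = level (lower i f) (atDist-suc i w e f) (atDist-tooClose (suc i) w e)
        where
        lower : ∀ i → ball adj i x w ≡ false → atDist adj i x w ≡ false
        lower zero f = f
        lower (suc i) f = atDist-tooFar i w f
      inner zero {true} far e f = closer f (atDist-tooClose 0 w f) (atDist-tooClose 1 w e)
      inner (suc i) {true} far e f = split′ refl
        where
        split′ : ∀ {b} → ball adj i x w ≡ b → Position (suc (suc i)) w
        split′ {true} g = ball-contra i w y g wy far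
        split′ {false} g = closer (atDist-suc i w f g) (atDist-tooClose (suc i) w f) (atDist-tooClose (suc (suc i)) w e)

sum-combination : ∀ {n} (P Q R : Fin n → ℚ) p q r →
  sum (λ w → P w * p + Q w * q + R w * r) ≡ sum P * p + sum Q * q + sum R * r
sum-combination {zero} P Q R p q r = solve 3 (λ p q r → con 0ℚ := con 0ℚ :* p :+ con 0ℚ :* q :+ con 0ℚ :* r) refl p q r
sum-combination {suc n} P Q R p q r = trans
  (cong (P fzero * p + Q fzero * q + R fzero * r +_) (sum-combination (λ i → P (fsuc i)) (λ i → Q (fsuc i)) (λ i → R (fsuc i)) p q r))
  (solve 9 (λ P Q R p q r P′ Q′ R′ → (P :* p :+ Q :* q :+ R :* r) :+ (P′ :* p :+ Q′ :* q :+ R′ :* r)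
                                   := (P :+ P′) :* p :+ (Q :+ Q′) :* q :+ (R :+ R′) :* r)
         refl (P fzero) (Q fzero) (R fzero) p q r (sum (λ i → P (fsuc i))) (sum (λ i → Q (fsuc i))) (sum (λ i → R (fsuc i))))

ι-suc-nonZero : ∀ k → ι (ℤ.+ suc k) ≢ 0ℚ
ι-suc-nonZero k = ι-nonZero {ℤ.+ suc k} (λ ())

divℕ-scale : ∀ m k → divℕ 2 (suc k) * ι (ℤ.+ m) ≡ 2ℚ * divℕ m (suc k)
divℕ-scale m k = *-cancelˡ-nonZero (ι (ℤ.+ suc k)) (ι-suc-nonZero k) (begin
  ι (ℤ.+ suc k) * (divℕ 2 (suc k) * ι (ℤ.+ m))   ≡⟨ *-assoc (ι (ℤ.+ suc k)) (divℕ 2 (suc k)) (ι (ℤ.+ m)) ⟨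
  ι (ℤ.+ suc k) * divℕ 2 (suc k) * ι (ℤ.+ m)     ≡⟨ cong₂ _*_ (ι-*-divℕ 2 k) (sym (ι-*-divℕ m k)) ⟩
  2ℚ * (ι (ℤ.+ suc k) * divℕ m (suc k))          ≡⟨ solve 3 (λ t k m → t :* (k :* m) := k :* (t :* m)) refl 2ℚ (ι (ℤ.+ suc k)) (divℕ m (suc k)) ⟩
  ι (ℤ.+ suc k) * (2ℚ * divℕ m (suc k))          ∎)
  where open ≡-Reasoning

divℕ-nonZero : ∀ m k → m ≢ 0 → divℕ m (suc k) ≢ 0ℚ
divℕ-nonZero m k m≢0 eq = m≢0 (ℤ.+-injective (ι-injective (trans (sym (ι-*-divℕ m k))
  (trans (cong (ι (ℤ.+ suc k) *_) eq) (*-zeroʳ (ι (ℤ.+ suc k)))))))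

-- As `f 0` is 1, a vanishing constant term of the product forces `y 0` to vanish, so tᵈ is
-- cancelled from `y` one factor at a time.
conv-strip : ∀ d f y g → f 0 ≡ 1ℚ → (∀ n → conv f y n ≡ g * shift d δ₀ n) → ∀ n → conv f (λ i → y (d ℕ.+ i)) n ≡ g * δ₀ n
conv-strip zero f y g f₀ eq n = eq n
conv-strip (suc d) f y g f₀ eq n = conv-strip d f (λ i → y (suc i)) g f₀ tail n
  where
  y₀ : y 0 ≡ 0ℚ
  y₀ = trans (sym (*-identityˡ (y 0))) (trans (cong (_* y 0) (sym f₀)) (trans (eq 0) (*-zeroʳ g)))
  tail : ∀ n → conv f (λ i → y (suc i)) n ≡ g * shift d δ₀ n
  tail n = begin
    conv f (λ i → y (suc i)) n                       ≡⟨ +-identityˡ _ ⟨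
    0ℚ + conv f (λ i → y (suc i)) n                  ≡⟨ cong (_+ conv f (λ i → y (suc i)) n) (trans (cong (f (suc n) *_) y₀) (*-zeroʳ (f (suc n)))) ⟨
    f (suc n) * y 0 + conv f (λ i → y (suc i)) n     ≡⟨ conv-last f y n ⟨
    conv f y (suc n)                                 ≡⟨ eq (suc n) ⟩
    g * shift d δ₀ n                                 ∎
    where open ≡-Reasoning

ι-2^ : ∀ j → ι (ℤ.+ (2 ^ j)) ≡ 2^ j
ι-2^ zero = refl
ι-2^ (suc j) = trans (cong ι (ℤ.pos-* 2 (2 ^ j))) (trans (ι-* (ℤ.+ 2) (ℤ.+ (2 ^ j))) (cong (2ℚ *_) (ι-2^ j)))

-- From functions on the vertices to the quotient matrix

module DistanceRegular {n : ℕ} (adj : Graph n) (k d : ℕ) (c a b : ℕ → ℕ)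
  (symmetric : ∀ u v → adj u v ≡ adj v u) (regular : ∀ v → deg adj v ≡ suc k) (x : Fin n)
  (diameter : ∀ y → ball adj d x y ≡ true) (b-last : b d ≡ 0)
  (count-ab : ∀ j → j ≤ d → ∀ y → atDist adj j x y ≡ true →
     count (λ z → adj y z ∧ atDist adj j x z) ≡ a j × count (λ z → adj y z ∧ atDist adj (suc j) x z) ≡ b j)
  (count-c : ∀ j → suc j ≤ d → ∀ y → atDist adj (suc j) x y ≡ true →
     count (λ z → adj y z ∧ atDist adj j x z) ≡ c (suc j))
  where

  open RegularGraph adj k symmetric regular
  open Distance adj x

  scaled : (ℕ → ℕ) → Seq
  scaled f i = 2ℚ * divℕ (f i) (suc k)

  b-last′ : scaled b d ≡ 0ℚ
  b-last′ = trans (cong (λ m → 2ℚ * divℕ m (suc k)) b-last) (trans (cong (2ℚ *_) (0/n≡0 (suc k))) (*-zeroʳ 2ℚ))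

  open Tridiagonal d (scaled a) (scaled b) (scaled c) b-last′

  Matches : (Fin n → ℚ) → Seq → Set
  Matches g h = ∀ i y → i ≤ d → atDist adj i x y ≡ true → g y ≡ h i

  -- The distance layers around `x` form an equitable partition: the number of neighbours in each
  -- adjacent layer depends on the layer alone. Hence `X` acts on layer-constant functions as B =
  -- 2Q/k acts on sequences.
  matches-X : ∀ {g h} → Matches g h → Matches (X g) (apply h)
  matches-X {g} {h} match i y i≤d yi = begin
    τ * sum (λ w → ⟦ adj w y ⟧ * g w)
      ≡⟨ cong (τ *_) (sum-cong-≗ pointwise) ⟩
    τ * sum (λ w → A w * h i + B w * h (suc i) + C w * shift 1 h i)
      ≡⟨ cong (τ *_) (sum-combination A B C (h i) (h (suc i)) (shift 1 h i)) ⟩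
    τ * (sum A * h i + sum B * h (suc i) + sum C * shift 1 h i)
      ≡⟨ cong (τ *_) (cong₂ _+_ (cong₂ (λ p q → p * h i + q * h (suc i)) A-sum B-sum) (C-sum i i≤d yi)) ⟩
    τ * (ι (ℤ.+ a i) * h i + ι (ℤ.+ b i) * h (suc i) + ι (ℤ.+ c i) * shift 1 h i)
      ≡⟨ solve 7 (λ t A B C p q r → t :* (A :* p :+ B :* q :+ C :* r) := (t :* A) :* p :+ (t :* B) :* q :+ (t :* C) :* r) refl
           τ (ι (ℤ.+ a i)) (ι (ℤ.+ b i)) (ι (ℤ.+ c i)) (h i) (h (suc i)) (shift 1 h i) ⟩
    (τ * ι (ℤ.+ a i)) * h i + (τ * ι (ℤ.+ b i)) * h (suc i) + (τ * ι (ℤ.+ c i)) * shift 1 h i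
      ≡⟨ cong₂ _+_ (cong₂ (λ p q → p * h i + q * h (suc i)) (divℕ-scale (a i) k) (divℕ-scale (b i) k))
                   (cong (_* shift 1 h i) (divℕ-scale (c i) k)) ⟩
    apply h i ∎
    where
    open ≡-Reasoning
    A B C : Fin n → ℚ
    A w = ⟦ adj y w ∧ atDist adj i x w ⟧
    B w = ⟦ adj y w ∧ atDist adj (suc i) x w ⟧
    C w = ⟦ adj y w ∧ atBelow i w ⟧
    A-sum : sum A ≡ ι (ℤ.+ a i)
    A-sum = trans (sym (count-sum (λ w → adj y w ∧ atDist adj i x w))) (cong (λ m → ι (ℤ.+ m)) (proj₁ (count-ab i i≤d y yi)))
    B-sum : sum B ≡ ι (ℤ.+ b i)
    B-sum = trans (sym (count-sum (λ w → adj y w ∧ atDist adj (suc i) x w))) (cong (λ m → ι (ℤ.+ m)) (proj₂ (count-ab i i≤d y yi)))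
    C-sum : ∀ i → i ≤ d → atDist adj i x y ≡ true →
      sum (λ w → ⟦ adj y w ∧ atBelow i w ⟧) * shift 1 h i ≡ ι (ℤ.+ c i) * shift 1 h i
    C-sum zero _ _ = trans (*-zeroʳ (sum (λ w → ⟦ adj y w ∧ false ⟧))) (sym (*-zeroʳ (ι (ℤ.+ c 0))))
    C-sum (suc i) i<d yi = cong (_* h i) (trans (sym (count-sum (λ w → adj y w ∧ atDist adj i x w)))
      (cong (λ m → ι (ℤ.+ m)) (count-c i i<d y yi)))
    value-below : ∀ i w → i ≤ d → atBelow i w ≡ true → g w ≡ shift 1 h i
    value-below (suc i) w i<d e = match i w (ℕ.<⇒≤ i<d) e
    -- `Matches` covers layer i + 1 only if i < d; a vertex outside ball i excludes i = d.
    inside : ∀ w → ball adj i x w ≡ false → suc i ≤ d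
    inside w e with ℕ.m≤n⇒m<n∨m≡n i≤d
    ... | inj₁ i<d = i<d
    ... | inj₂ refl with () ← trans (sym (diameter w)) e
    neighbour : ∀ w → Position i w →
      g w ≡ ⟦ atDist adj i x w ⟧ * h i + ⟦ atDist adj (suc i) x w ⟧ * h (suc i) + ⟦ atBelow i w ⟧ * shift 1 h i
    neighbour w (closer e₀ e₁ e₂) = trans (value-below i w i≤d e₀) (trans
      (solve 3 (λ p q r → r := con 0ℚ :* p :+ con 0ℚ :* q :+ con 1ℚ :* r) refl (h i) (h (suc i)) (shift 1 h i))
      (sym (cong₂ _+_ (cong₂ (λ s t → ⟦ s ⟧ * h i + ⟦ t ⟧ * h (suc i)) e₁ e₂) (cong (λ s → ⟦ s ⟧ * shift 1 h i) e₀))))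
    neighbour w (level e₀ e₁ e₂) = trans (match i w i≤d e₁) (trans
      (solve 3 (λ p q r → p := con 1ℚ :* p :+ con 0ℚ :* q :+ con 0ℚ :* r) refl (h i) (h (suc i)) (shift 1 h i))
      (sym (cong₂ _+_ (cong₂ (λ s t → ⟦ s ⟧ * h i + ⟦ t ⟧ * h (suc i)) e₁ e₂) (cong (λ s → ⟦ s ⟧ * shift 1 h i) e₀))))
    neighbour w (farther e₀ e₁ e₂ e) = trans (match (suc i) w (inside w e) e₂) (trans
      (solve 3 (λ p q r → q := con 0ℚ :* p :+ con 1ℚ :* q :+ con 0ℚ :* r) refl (h i) (h (suc i)) (shift 1 h i))
      (sym (cong₂ _+_ (cong₂ (λ s t → ⟦ s ⟧ * h i + ⟦ t ⟧ * h (suc i)) e₁ e₂) (cong (λ s → ⟦ s ⟧ * shift 1 h i) e₀))))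
    weighted : ∀ w {q} → adj w y ≡ q → ⟦ q ⟧ * g w ≡
      ⟦ q ∧ atDist adj i x w ⟧ * h i + ⟦ q ∧ atDist adj (suc i) x w ⟧ * h (suc i) + ⟦ q ∧ atBelow i w ⟧ * shift 1 h i
    weighted w {true} e = trans (*-identityˡ (g w)) (neighbour w (position symmetric i y w yi e))
    weighted w {false} e = solve 4 (λ g p q r → con 0ℚ :* g := con 0ℚ :* p :+ con 0ℚ :* q :+ con 0ℚ :* r) refl (g w) (h i) (h (suc i)) (shift 1 h i)
    pointwise : ∀ w → ⟦ adj w y ⟧ * g w ≡ A w * h i + B w * h (suc i) + C w * shift 1 h i
    pointwise w = trans (weighted w refl)
      (cong (λ q → ⟦ q ∧ atDist adj i x w ⟧ * h i + ⟦ q ∧ atDist adj (suc i) x w ⟧ * h (suc i) + ⟦ q ∧ atBelow i w ⟧ * shift 1 h i)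
            (symmetric w y))

  matches-X^ : ∀ {g} → Matches g δ₀ → ∀ n → Matches (X^ n g) (column n)
  matches-X^ match zero = match
  matches-X^ match (suc n) = matches-X (matches-X^ match n)

  -- A geodesic from `x` to a vertex at distance d meets every layer, and its vertex on layer i + 1
  -- has a predecessor that `c (suc i)` counts.
  c-nonZero : ∀ y → atDist adj d x y ≡ true → ∀ i → suc i ≤ d → c (suc i) ≢ 0
  c-nonZero y yd i i<d eq =
    let z , zi = geodesic d y yd (suc i) i<d
        w , wz , wi = predecessor i z zi
    in count-nonZero (λ w → adj z w ∧ atDist adj i x w) w (cong₂ _∧_ (trans (symmetric z w) wz) wi)
         (trans (count-c i i<d z zi) eq)

  Γ-nonZero : ∀ y → atDist adj d x y ≡ true → ∀ i → i ≤ d → Γ i ≢ 0ℚ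
  Γ-nonZero y yd zero _ = λ ()
  Γ-nonZero y yd (suc i) i<d = *-nonZero
    (*-nonZero {2ℚ} {divℕ (c (suc i)) (suc k)} (λ ()) (divℕ-nonZero (c (suc i)) k (c-nonZero y yd i i<d)))
    (Γ-nonZero y yd i (ℕ.<⇒≤ i<d))

  module _ (w : Fin n) (wx : adj w x ≡ true) where

    open Orbit (w , x)

    incoming-0 : ∀ u → incoming 0 u ≡ ⟦ adj w u ⟧ * ⟦ u =ᶠ x ⟧
    incoming-0 u = trans (sum-cong-≗ (λ v → trans (cong (⟦ adj v u ⟧ *_) (⟦⟧-∧ (v =ᶠ w) (u =ᶠ x)))
        (solve 3 (λ a p q → a :* (p :* q) := p :* (a :* q)) refl ⟦ adj v u ⟧ ⟦ v =ᶠ w ⟧ ⟦ u =ᶠ x ⟧)))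
      (sum-pick w (λ v → ⟦ adj v u ⟧ * ⟦ u =ᶠ x ⟧))

    incoming-matches : Matches (incoming 0) δ₀
    incoming-matches zero y _ e with =ᶠ⇒≡ x y e
    ... | refl = trans (incoming-0 x) (cong₂ (λ p q → ⟦ p ⟧ * ⟦ q ⟧) wx e)
    incoming-matches (suc i) y _ e =
      trans (incoming-0 y) (trans (cong (λ q → ⟦ adj w y ⟧ * ⟦ q ⟧) (trans (≡ᵇ-sym (toℕ y) (toℕ x)) (away i (proj₂ (atDist-suc⁻¹ i y e))))) (*-zeroʳ ⟦ adj w y ⟧))
      where
      away : ∀ i → ball adj i x y ≡ false → (x =ᶠ y) ≡ false
      away zero e = e
      away (suc i) e with ball adj i x y in f
      ... | false = away i f

    -- `trailing 0` is the continuant of `charPoly-reciprocal` by computation. The series paired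
    -- with it starts at Bᵈ: cutting off the first d terms of the entry (d,0) makes the product the
    -- constant `Γ d`, as `fatou` requires.
    charPoly-integral : ∀ y → atDist adj d x y ≡ true → ∀ m → (∀ e → IsArc adj e → ψ (suc m) e ≡ ψ 0 e) →
      ∀ s → IsInt (trailing 0 s)
    charPoly-integral y yd m period s =
      let K , K≢0 , integral = bounded-denominators m period y
      -- The determinant has degree at most d + 1, so its coefficients vanish from index d + 2 on.
      in fatou (suc (suc d)) (trailing 0) (λ n → column (d ℕ.+ n) d) (Γ d) K
           (continuant-head (suc d) (scaled a) κ)
           (λ s → Reciprocal.degʳ (charPoly-reciprocal (suc k) (suc d) c a b) s)
           (Γ-nonZero y yd d ℕ.≤-refl) K≢0
           (λ n → subst (λ q → IsInt (ι K * q)) (matches-X^ incoming-matches (d ℕ.+ n) d y ℕ.≤-refl yd) (integral (d ℕ.+ n) 0))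
           (conv-strip d (trailing 0) (λ n → column n d) (Γ d) (continuant-head (suc d) (scaled a) κ)
             (λ n → trans (charPoly-conv-column n d ℕ.≤-refl) (cong (Γ d *_) (shift-cong trailing-last d n))))
           s

open import Data.Integer using (+_)

theorem1p5 : ∀ {n} (adj : Graph n) (k d : ℕ) (c a b : ℕ → ℕ) →
    IsDistanceRegular adj k d c a b → Periodic adj →
    ∀ j → 1 ≤ j → j ≤ d →
    ∃ λ (z : ℤ) → ((+ (2 ^ j)) / 1) * coeff (charPoly (suc d) (normQuotientMatrix k d c a b)) (suc d ∸ j) ≡ z / 1
-- A positive diameter yields an edge, which contradicts valency 0.
theorem1p5 adj zero (suc d) c a b ((symmetric , _) , _ , regular , (_ , x , y , yd) , _) _ j _ _ =
  let z , zy , _ = Distance.predecessor adj x d y yd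
  in contradiction (regular z) (count-nonZero (adj z) y zy)
theorem1p5 adj (suc k) (suc d) c a b
  ((symmetric , _) , _ , regular , (diameter , x , y , yd) , _ , b-last , count-ab , count-c) (suc m , _ , period) j _ j≤d =
  let open Distance adj x
      -- The orbit starts from an arc ending at `x`. A vertex at distance 1 supplies it, since its
      -- predecessor at distance 0 can only be `x`.
      u , u₁ = geodesic (suc d) y yd 1 (s≤s z≤n)
      z , zu , z₀ = predecessor 0 u u₁
      ux = trans (symmetric u x) (trans (cong (λ v → adj v u) (=ᶠ⇒≡ x z z₀)) zu)
      open DistanceRegular adj k (suc d) c a b symmetric regular x (diameter x) b-last
             (λ j j≤d → count-ab j j≤d x) (λ j j<d → count-c j j<d x)
      i , eq = charPoly-integral u ux y yd m (λ e arc → period e (u , x) arc ux) j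
  in i , trans (cong (_* coeff (charPoly (suc (suc d)) (normQuotientMatrix (suc k) (suc d) c a b)) (suc (suc d) ∸ j)) (ι-2^ j))
       (trans (Reciprocal.reverse (charPoly-reciprocal (suc k) (suc (suc d)) c a b) j (suc (suc d) ∸ j)
                (ℕ.m+[n∸m]≡n (ℕ.m≤n⇒m≤1+n j≤d)))
              eq)
theorem1p5 adj k zero c a b _ _ (suc j) _ ()
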